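{- For every pattern $\tau\in\{12312,\,12132,\,12123,\,12321,\,12231,\,12213\}$ and every $n\ge1$, the number of matchings on $[2n]$ avoiding $\tau$ equals $C_{n,3}=\frac{1}{2n+1}\binom{3n}{n}$.
   Context: A matching on $[2n]$ is a partition of $[2n]$ into $n$ blocks of size two (edges). The canonical sequential form of a matching with $n$ edges is the word of length $2n$ obtained by labeling edges $1,\dots,n$ in increasing order of their smaller elements and writing at each position the label of the edge containing it. Words $a_1\cdots a_k$, $b_1\cdots b_k$ are order-isomorphic if $a_i<a_j\iff b_i<b_j$ for all $i,j$. A matching contains a pattern $\tau$ if its canonical sequential form has a subsequence order-isomorphic to $\tau$, and avoids $\tau$ otherwise. -}

module Defs where

open import Data.Nat using (ℕ; zero; suc; _+_; _*_; _<ᵇ_; _≡ᵇ_; _≤ᵇ_)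
open import Data.Bool using (Bool; true; false; _∧_; _∨_; not; if_then_else_)
open import Data.Fin using (Fin; toℕ)
open import Data.List using (List; []; _∷_; map; concatMap; filter; length; allFin; zip)
open import Data.Bool.ListAction using (and; or)
open import Data.Vec using (Vec; lookup; toList)
import Data.Vec as V
open import Relation.Binary.PropositionalEquality using (_≡_)
open import Relation.Nullary.Decidable using (Dec; yes; no)
open import Data.Bool.Properties using () renaming (_≟_ to _≟ᵇ_)

allVecs : (m k : ℕ) → List (Vec (Fin m) k)
allVecs m zero    = V.[] ∷ []
allVecs m (suc k) = concatMap (λ x → map (x V.∷_) (allVecs m k)) (allFin m)

-- A matching on [N] (N = 2n) is encoded by its partner function p : [N] → [N]
-- (edges are the blocks {i , p i}); it is a matching iff p is a fixed-point-free
-- involution.  This is a bijective encoding of perfect matchings of [N].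
isMatching : {N : ℕ} → Vec (Fin N) N → Bool
isMatching {N} p =
  and (map (λ i → (toℕ (lookup p (lookup p i)) ≡ᵇ toℕ i)
                  ∧ not (toℕ (lookup p i) ≡ᵇ toℕ i)) (allFin N))

-- Edges are labelled 1..n in increasing order of their smaller element;
-- the label of the edge containing position i is the number of edge-openers
-- j (j < p j) with j ≤ min(i, p i).
min : ℕ → ℕ → ℕ
min a b = if a ≤ᵇ b then a else b

label : {N : ℕ} → Vec (Fin N) N → Fin N → ℕ
label {N} p i =
  length (filter (λ j → (toℕ j <ᵇ toℕ (lookup p j)) ≟ᵇ true
                       ) (filter (λ j → (toℕ j ≤ᵇ min (toℕ i) (toℕ (lookup p i))) ≟ᵇ true)
                                 (allFin N)))

canonical : {N : ℕ} → Vec (Fin N) N → List ℕ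
canonical {N} p = map (label p) (allFin N)

subseqs : List ℕ → List (List ℕ)
subseqs []       = [] ∷ []
subseqs (x ∷ xs) = let r = subseqs xs in map (x ∷_) r Data.List.++ r

sameLength : List ℕ → List ℕ → Bool
sameLength []       []       = true
sameLength (_ ∷ a) (_ ∷ b)   = sameLength a b
sameLength _        _        = false

orderIso : List ℕ → List ℕ → Bool
orderIso a b =
  sameLength a b ∧
  and (map (λ xy → and (map (λ uv →
         (Data.Product.proj₁ xy <ᵇ Data.Product.proj₁ uv)
           ≡ᵇ' (Data.Product.proj₂ xy <ᵇ Data.Product.proj₂ uv)) ps)) ps)
  where
    import Data.Product
    ps = zip a b
    _≡ᵇ'_ : Bool → Bool → Bool
    true  ≡ᵇ' y = y
    false ≡ᵇ' y = not y

contains : List ℕ → List ℕ → Bool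
contains w τ = or (map (λ s → orderIso s τ) (subseqs w))

avoids : List ℕ → {N : ℕ} → Vec (Fin N) N → Bool
avoids τ p = not (contains (canonical p) τ)

countAvoiders : List ℕ → ℕ → ℕ
countAvoiders τ n =
  length (filter (λ p → (isMatching p ∧ avoids τ p) ≟ᵇ true) (allVecs (2 * n) (2 * n)))

{-# OPTIONS --safe #-}
module Submission where

open import Defs
import Data.Nat
open import Data.Bool using (Bool; true; false; _∧_; not; if_then_else_)
open import Data.Bool.ListAction using (and; or)
open import Data.Bool.Properties using (T-≡) renaming (_≟_ to _≟ᵇ_)
open import Data.Empty using (⊥; ⊥-elim)
open import Data.Fin using (Fin; zero; suc; toℕ)
open import Data.Fin.Properties using (toℕ-injective)
import Data.List as List
open import Data.List using (List; _∷_; []; _++_; _ʳ++_; map; concatMap; filter; length; reverse; zip; allFin; tabulate; applyUpTo)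
open import Data.List.Membership.DecPropositional Data.Nat._≟_ using (_∈?_)
open import Data.List.Membership.Propositional using (_∈_; _∉_; find; lose)
open import Data.List.Membership.Propositional.Properties using (∈-map⁺; ∈-map⁻; ∈-++⁺ˡ; ∈-++⁺ʳ; ∈-++⁻; ∈-concatMap⁺; ∈-concatMap⁻; ∈-allFin; ∈-filter⁺; ∈-filter⁻; ∈-tabulate⁺; ∈-applyUpTo⁺; ∈-applyUpTo⁻)
open import Data.List.Membership.Propositional.Properties.WithK using (unique∧set⇒bag)
open import Data.List.Properties using (++-assoc; ++-identityʳ; ʳ++-defn; ++-ʳ++; reverse-++; reverse-involutive; reverse-injective; unfold-reverse; ∷-injective; ∷-injectiveˡ; ∷-injectiveʳ; map-∘; map-++; map-cong; map-ʳ++; map-tabulate; filter-accept; filter-reject; tabulate-lookup; tabulate-cong; length-map; length-tabulate; length-applyUpTo)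
open import Data.List.Relation.Binary.BagAndSetEquality using (∼bag⇒↭)
open import Data.List.Relation.Binary.Permutation.Propositional.Properties using (↭-length)
open import Data.List.Relation.Binary.Sublist.DecPropositional Data.Nat._≟_ using (_⊆_; []; _∷_; _∷ʳ_; _⊆?_; ⊆-refl; ⊆-trans; minimum; from∈)
  renaming (lookup to ⊆-lookup)
open import Data.List.Relation.Binary.Sublist.Propositional.Properties using (++⁺ˡ; ʳ++⁺; ∷ˡ⁻)
  renaming (++⁺ to ⊆-++⁺)
open import Data.List.Relation.Unary.All as All using (All; []; _∷_)
open import Data.List.Relation.Unary.All.Properties using () renaming (++⁺ to All-++⁺)
open import Data.List.Relation.Unary.AllPairs using ([]; _∷_)
open import Data.List.Relation.Unary.Any using (here; there; any?)
open import Data.List.Relation.Unary.Any.Properties using (reverse⁻; reverseAcc⁺; reverseAcc⁻)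
open import Data.List.Relation.Unary.Unique.Propositional using (Unique)
open import Data.List.Relation.Unary.Unique.Propositional.Properties using (allFin⁺; filter⁺; applyUpTo⁺₁)
  renaming (++⁺ to Unique-++⁺)
open import Data.Nat
open import Data.Nat.Combinatorics using (_C_; nCk+nC[k+1]≡[n+1]C[k+1]; nCk≡nC[n∸k]; nC1≡n; k>n⇒nCk≡0)
open import Data.Nat.DivMod using (_/_; m*n/n≡m)
open import Data.Nat.ListAction using (sum)
open import Data.Nat.ListAction.Properties using (sum-++)
open import Data.Nat.Properties
open import Data.Nat.Tactic.RingSolver using (solve-∀)
open import Data.Product using (_×_; _,_; proj₁; proj₂; ∃)
open import Data.Sum using (_⊎_; inj₁; inj₂; swap)
open import Data.Vec using (Vec; lookup)
import Data.Vec as Vec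
import Data.Vec.Properties as Vecₚ
open import Function using (_∘_; id; Equivalence; mk⇔)
open import Relation.Binary.Definitions using (tri<; tri≈; tri>)
open import Relation.Binary.PropositionalEquality
open import Relation.Nullary using (¬_; Dec; yes; no; contradiction; ¬?)
open import Relation.Nullary.Decidable using (map′; _×-dec_)

-- A pattern is α c β with c its largest letter, which occurs once.  In a canonical word with n edges
-- the edge with a new largest label c = n + 1 is opened at a cut behind all openers and closed at the same
-- or a later cut, and the new word avoids the pattern iff the old one does and, at both cuts, no a < b
-- have α before and β behind the cut.  If K cuts of a word are admissible in this sense, then for each
-- of the six patterns the extensions whose edge is opened at the i-th last admissible cut have, in
-- some order, 2, 3, …, i + 1 admissible cuts.  Hence all six generate the same tree, in which a node
-- labelled K has the children 2, …, i + 1 for each i = 1, …, K.  Its level sums are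
-- ballot numbers, counting lattice paths countBefore a line of slope 1/2.

-- Ballot numbers

-- The labels 2, ..., i + 1 arise as follows. The new letter c exceeds all others, so an occurrence
-- of α and β around a cut that uses c must use it as b. The admissible cuts of a child lie between
-- the two copies of c or behind the second one. For each pattern, one of these stretches keeps
-- exactly the parent's admissible cuts and the other keeps one cut or none. Only the choice of the
-- stretch and the place of the surviving cut depend on the pattern; for 12321 it matters whether
-- the edge closes at the end, for 12123 whether it closes at once.
--
-- The slope 1/2 has a simple source: summing f over the children of a node K gives a double partial
-- sum of f shifted by one. A level contributes two summations (two horizontal steps) and one shift
-- (one step up). Carrying an arbitrary test function through the induction turns this into
-- summation by parts.
--
-- Matchings and tree are compared without a recursive bijection: canonical words of avoiding
-- matchings and words of the tree form two duplicate-free lists with the same members.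

absorption : ∀ n k → suc k * (suc n C suc k) ≡ suc n * (n C k)
absorption n zero = trans (*-identityˡ _) (trans (nC1≡n (suc n)) (sym (*-identityʳ (suc n))))
absorption zero (suc k) = trans (cong (suc (suc k) *_) (k>n⇒nCk≡0 {1} {suc (suc k)} (s≤s (s≤s z≤n))))
  (trans (*-zeroʳ (suc (suc k))) (sym (trans (*-identityˡ _) (k>n⇒nCk≡0 {0} {suc k} (s≤s z≤n)))))
absorption (suc n) (suc k) = begin
  suc (suc k) * (suc (suc n) C suc (suc k))
    ≡⟨ cong (suc (suc k) *_) (sym (nCk+nC[k+1]≡[n+1]C[k+1] (suc n) (suc k))) ⟩
  suc (suc k) * (x + (suc n C suc (suc k)))
    ≡⟨ *-distribˡ-+ (suc (suc k)) x _ ⟩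
  suc (suc k) * x + suc (suc k) * (suc n C suc (suc k))
    ≡⟨ cong (suc (suc k) * x +_) (absorption n (suc k)) ⟩
  (x + suc k * x) + suc n * (n C suc k)
    ≡⟨ cong (λ y → (x + y) + suc n * (n C suc k)) (absorption n k) ⟩
  (x + suc n * (n C k)) + suc n * (n C suc k)
    ≡⟨ +-assoc x _ _ ⟩
  x + (suc n * (n C k) + suc n * (n C suc k))
    ≡⟨ cong (x +_) (sym (*-distribˡ-+ (suc n) (n C k) _)) ⟩
  x + suc n * ((n C k) + (n C suc k))
    ≡⟨ cong (λ y → x + suc n * y) (nCk+nC[k+1]≡[n+1]C[k+1] n k) ⟩
  suc (suc n) * x ∎
  where
  open ≡-Reasoning
  x = suc n C suc k

paths : ℕ → ℕ → ℕ
paths a b = (a + b) C b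

paths-step : ∀ a b → paths (suc a) (suc b) ≡ paths (suc a) b + paths a (suc b)
paths-step a b = begin
  (suc a + suc b) C suc b                     ≡⟨ cong (_C suc b) (cong suc (+-suc a b)) ⟩
  suc (suc a + b) C suc b                     ≡⟨ sym (nCk+nC[k+1]≡[n+1]C[k+1] (suc a + b) b) ⟩
  paths (suc a) b + ((suc a + b) C suc b)     ≡⟨ cong (λ n → paths (suc a) b + (n C suc b)) (sym (+-suc a b)) ⟩
  paths (suc a) b + paths a (suc b)           ∎
  where open ≡-Reasoning

paths-sym : ∀ a b → paths a b ≡ (a + b) C a
paths-sym a b = trans (nCk≡nC[n∸k] (m≤n+m b a)) (cong ((a + b) C_) (m+n∸n≡m a b))

-- Both sides equal (a + b + 1) times `paths a b`: absorption is applied once in each coordinate.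
paths-ratio : ∀ a b → suc b * paths a (suc b) ≡ suc a * paths (suc a) b
paths-ratio a b = begin
  suc b * ((a + suc b) C suc b) ≡⟨ cong (λ n → suc b * (n C suc b)) (+-suc a b) ⟩
  suc b * (suc (a + b) C suc b) ≡⟨ absorption (a + b) b ⟩
  suc (a + b) * paths a b       ≡⟨ cong (suc (a + b) *_) (paths-sym a b) ⟩
  suc (a + b) * ((a + b) C a)   ≡⟨ sym (absorption (a + b) a) ⟩
  suc a * (suc (a + b) C suc a) ≡⟨ cong (suc a *_) (sym (paths-sym (suc a) b)) ⟩
  suc a * paths (suc a) b       ∎
  where open ≡-Reasoning

-- Lattice paths to (a , b) that stay in a ≥ 2 b.  For a + 1 < 2 b the truncated subtraction gives 0.
ballot : ℕ → ℕ → ℕ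
ballot a zero    = 1
ballot a (suc b) = paths a (suc b) ∸ 2 * paths (suc a) b

private
  ratio₂ : ∀ a b → suc a * (2 * paths (suc a) b) ≡ 2 * suc b * paths a (suc b)
  ratio₂ a b = begin
    suc a * (2 * paths (suc a) b) ≡⟨ lem (suc a) (paths (suc a) b) ⟩
    2 * (suc a * paths (suc a) b) ≡⟨ cong (2 *_) (sym (paths-ratio a b)) ⟩
    2 * (suc b * paths a (suc b)) ≡⟨ sym (*-assoc 2 (suc b) _) ⟩
    2 * suc b * paths a (suc b) ∎
    where
    open ≡-Reasoning
    lem : ∀ x y → x * (2 * y) ≡ 2 * (x * y)
    lem = solve-∀

-- Multiplied by a + 1, the subtracted term becomes 2 (b + 1) times `paths a (suc b)`, so the
-- hypothesis makes the subtraction exact.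
ballot-untruncated : ∀ a b → 2 * suc b ≤ suc a → ballot a (suc b) + 2 * paths (suc a) b ≡ paths a (suc b)
ballot-untruncated a b h = m∸n+n≡m (*-cancelˡ-≤ (suc a) (begin
  suc a * (2 * paths (suc a) b) ≡⟨ ratio₂ a b ⟩
  2 * suc b * paths a (suc b)   ≤⟨ *-monoˡ-≤ (paths a (suc b)) h ⟩
  suc a * paths a (suc b)       ∎))
  where open ≤-Reasoning

-- These points lie one step left of the boundary; the two terms of the closed form cancel there, so
-- sums may run one term past the boundary.
ballot-zero : ∀ a b → 2 * suc b ≡ suc a → ballot a (suc b) ≡ 0
ballot-zero a b h = m≤n⇒m∸n≡0 (*-cancelˡ-≤ (suc a) (begin
  suc a * paths a (suc b)       ≡⟨ cong (_* paths a (suc b)) (sym h) ⟩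
  2 * suc b * paths a (suc b)   ≡⟨ sym (ratio₂ a b) ⟩
  suc a * (2 * paths (suc a) b) ∎))
  where open ≤-Reasoning

private
  -- Pascal's rule on the subtracted term makes row zero no exception, which spares `ballot-step` a
  -- case split on b.
  ballot-untruncated′ : ∀ a b → 2 * suc b ≤ suc a → ballot (suc a) b + 2 * paths (suc (suc a)) b ≡ paths (suc a) b + 2 * paths (suc a) b
  ballot-untruncated′ a zero h = refl
  ballot-untruncated′ a (suc b) h = begin
    ballot (suc a) (suc b) + 2 * paths (suc (suc a)) (suc b)
      ≡⟨ cong (λ x → ballot (suc a) (suc b) + 2 * x) (paths-step (suc a) b) ⟩
    ballot (suc a) (suc b) + 2 * (paths (suc (suc a)) b + paths (suc a) (suc b))
      ≡⟨ cong (ballot (suc a) (suc b) +_) (*-distribˡ-+ 2 (paths (suc (suc a)) b) _) ⟩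
    ballot (suc a) (suc b) + (2 * paths (suc (suc a)) b + 2 * paths (suc a) (suc b))
      ≡⟨ sym (+-assoc (ballot (suc a) (suc b)) _ _) ⟩
    (ballot (suc a) (suc b) + 2 * paths (suc (suc a)) b) + 2 * paths (suc a) (suc b)
      ≡⟨ cong (_+ 2 * paths (suc a) (suc b)) (ballot-untruncated (suc a) b (≤-trans (*-monoʳ-≤ 2 (n≤1+n (suc b))) (≤-trans h (n≤1+n _)))) ⟩
    paths (suc a) (suc b) + 2 * paths (suc a) (suc b) ∎
    where open ≡-Reasoning

-- The last step of a path is vertical or horizontal. The closed forms are compared after adding the
-- subtracted terms back.
ballot-step : ∀ a b → 2 * suc b ≤ suc a → ballot (suc a) (suc b) ≡ ballot (suc a) b + ballot a (suc b)
ballot-step a b h = +-cancelʳ-≡ (2 * paths (suc (suc a)) b) _ _ (begin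
  ballot (suc a) (suc b) + 2 * paths (suc (suc a)) b
    ≡⟨ ballot-untruncated (suc a) b (≤-trans h (n≤1+n _)) ⟩
  paths (suc a) (suc b)
    ≡⟨ paths-step a b ⟩
  paths (suc a) b + paths a (suc b)
    ≡⟨ cong (paths (suc a) b +_) (sym (ballot-untruncated a b h)) ⟩
  paths (suc a) b + (ballot a (suc b) + 2 * paths (suc a) b)
    ≡⟨ lem (paths (suc a) b) (ballot a (suc b)) (2 * paths (suc a) b) ⟩
  (paths (suc a) b + 2 * paths (suc a) b) + ballot a (suc b)
    ≡⟨ cong (_+ ballot a (suc b)) (sym (ballot-untruncated′ a b h)) ⟩
  (ballot (suc a) b + 2 * paths (suc (suc a)) b) + ballot a (suc b)
    ≡⟨ lem′ (ballot (suc a) b) (2 * paths (suc (suc a)) b) (ballot a (suc b)) ⟩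
  (ballot (suc a) b + ballot a (suc b)) + 2 * paths (suc (suc a)) b ∎)
  where
  open ≡-Reasoning
  lem : ∀ x y z → x + (y + z) ≡ (x + z) + y
  lem = solve-∀
  lem′ : ∀ x y z → (x + y) + z ≡ (x + z) + y
  lem′ = solve-∀

ballot-diagonal : ∀ n → ballot (2 * n) n ≡ ((3 * n) C n) / suc (2 * n)
ballot-diagonal zero = refl
ballot-diagonal n@(suc m) = begin
  ballot (2 * n) n                                   ≡⟨ sym (m*n/n≡m (ballot (2 * n) n) (suc (2 * n))) ⟩
  (ballot (2 * n) n * suc (2 * n)) / suc (2 * n)     ≡⟨ cong (_/ suc (2 * n)) key ⟩
  paths (2 * n) n / suc (2 * n)                      ≡⟨ cong (λ k → (k C n) / suc (2 * n)) (lem n) ⟩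
  ((3 * n) C n) / suc (2 * n)                        ∎
  where
  open ≡-Reasoning
  lem : ∀ n → 2 * n + n ≡ 3 * n
  lem = solve-∀
  lem′ : ∀ x y z → (x + 2 * y) * suc z ≡ x * suc z + suc z * (2 * y)
  lem′ = solve-∀
  lem″ : ∀ n x → x * suc (2 * n) ≡ x + 2 * n * x
  lem″ = solve-∀
  p = 2 * paths (suc (2 * n)) m
  key : ballot (2 * n) n * suc (2 * n) ≡ paths (2 * n) n
  -- Once 2 n times the path number is added, `ratio₂` turns the addend into 2 n + 1 times the
  -- subtracted term `p`.
  key = +-cancelʳ-≡ (2 * n * paths (2 * n) n) _ _ (begin
    ballot (2 * n) n * suc (2 * n) + 2 * n * paths (2 * n) n
      ≡⟨ cong (ballot (2 * n) n * suc (2 * n) +_) (sym (ratio₂ (2 * n) m)) ⟩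
    ballot (2 * n) n * suc (2 * n) + suc (2 * n) * p
      ≡⟨ sym (lem′ (ballot (2 * n) n) (paths (suc (2 * n)) m) (2 * n)) ⟩
    (ballot (2 * n) n + p) * suc (2 * n)
      ≡⟨ cong (_* suc (2 * n)) (ballot-untruncated (2 * n) m (n≤1+n _)) ⟩
    paths (2 * n) n * suc (2 * n)
      ≡⟨ lem″ n (paths (2 * n) n) ⟩
    paths (2 * n) n + 2 * n * paths (2 * n) n ∎)

-- Partial sums and convolution with ballot numbers.

sum₁ : (ℕ → ℕ) → ℕ → ℕ
sum₁ f zero    = 0
sum₁ f (suc n) = sum₁ f n + f (suc n)

sum₀ : (ℕ → ℕ) → ℕ → ℕ
sum₀ f zero    = f 0
sum₀ f (suc n) = sum₀ f n + f (suc n)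

sum₁-cong : ∀ {f g} → (∀ i → f (suc i) ≡ g (suc i)) → ∀ n → sum₁ f n ≡ sum₁ g n
sum₁-cong h zero    = refl
sum₁-cong h (suc n) = cong₂ _+_ (sum₁-cong h n) (h n)

-- conv u g n = Σ_{i ≤ n} u i · g (n + 1 − i)
conv : (ℕ → ℕ) → (ℕ → ℕ) → ℕ → ℕ
conv u g zero    = u 0 * g 1
conv u g (suc n) = u 0 * g (suc (suc n)) + conv (u ∘ suc) g n

conv-cong : ∀ {u v g h} n → (∀ i → i ≤ n → u i ≡ v i) → (∀ i → g (suc i) ≡ h (suc i)) → conv u g n ≡ conv v h n
conv-cong zero    p q = cong₂ _*_ (p 0 z≤n) (q 0)
conv-cong (suc n) p q = cong₂ _+_ (cong₂ _*_ (p 0 z≤n) (q (suc n))) (conv-cong n (λ i h → p (suc i) (s≤s h)) q)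

conv-last : ∀ u g n → conv u g (suc n) ≡ conv u (g ∘ suc) n + u (suc n) * g 1
conv-last u g zero    = refl
conv-last u g (suc n) = trans (cong (u 0 * g (3 + n) +_) (conv-last (u ∘ suc) g n)) (sym (+-assoc (u 0 * g (3 + n)) _ _))

conv-+ˡ : ∀ u v g n → conv (λ i → u i + v i) g n ≡ conv u g n + conv v g n
conv-+ˡ u v g zero    = *-distribʳ-+ (g 1) (u 0) (v 0)
conv-+ˡ u v g (suc n) = trans (cong₂ _+_ (*-distribʳ-+ (g (suc (suc n))) (u 0) (v 0)) (conv-+ˡ (u ∘ suc) (v ∘ suc) g n))
  (lem (u 0 * g (suc (suc n))) _ _ _)
  where
  lem : ∀ x y z w → (x + y) + (z + w) ≡ (x + z) + (y + w)
  lem = solve-∀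

conv-+ʳ : ∀ u g h n → conv u (λ i → g i + h i) n ≡ conv u g n + conv u h n
conv-+ʳ u g h zero    = *-distribˡ-+ (u 0) (g 1) (h 1)
conv-+ʳ u g h (suc n) = trans (cong₂ _+_ (*-distribˡ-+ (u 0) (g (suc (suc n))) _) (conv-+ʳ (u ∘ suc) g h n))
  (lem (u 0 * g (suc (suc n))) _ _ _)
  where
  lem : ∀ x y z w → (x + y) + (z + w) ≡ (x + z) + (y + w)
  lem = solve-∀

-- Summation by parts: the partial sums move from one factor to the other.
conv-sum : ∀ u g n → conv u (sum₁ g) n ≡ conv (sum₀ u) g n
conv-sum u g zero    = refl
conv-sum u g (suc n) = begin
  conv u (sum₁ g) (suc n)
    ≡⟨ conv-last u (sum₁ g) n ⟩
  conv u (λ i → sum₁ g i + g (suc i)) n + u (suc n) * g 1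
    ≡⟨ cong (_+ u (suc n) * g 1) (conv-+ʳ u (sum₁ g) (g ∘ suc) n) ⟩
  (conv u (sum₁ g) n + conv u (g ∘ suc) n) + u (suc n) * g 1
    ≡⟨ +-assoc (conv u (sum₁ g) n) _ _ ⟩
  conv u (sum₁ g) n + (conv u (g ∘ suc) n + u (suc n) * g 1)
    ≡⟨ cong₂ _+_ (conv-sum u g n) (sym (conv-last u g n)) ⟩
  conv (sum₀ u) g n + (u 0 * g (suc (suc n)) + conv (u ∘ suc) g n)
    ≡⟨ lem (conv (sum₀ u) g n) (u 0 * g (suc (suc n))) (conv (u ∘ suc) g n) ⟩
  u 0 * g (suc (suc n)) + (conv (sum₀ u) g n + conv (u ∘ suc) g n)
    ≡⟨ cong (u 0 * g (suc (suc n)) +_) (sym (conv-+ˡ (sum₀ u) (u ∘ suc) g n)) ⟩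
  conv (sum₀ u) g (suc n) ∎
  where
  open ≡-Reasoning
  lem : ∀ x y z → x + (y + z) ≡ y + (x + z)
  lem = solve-∀

-- Paths to (a + 1, b) are sorted by the height of their last horizontal step.
sum₀-ballot : ∀ a b → 2 * b ≤ suc a → sum₀ (ballot a) b ≡ ballot (suc a) b
sum₀-ballot a zero    h = refl
sum₀-ballot a (suc b) h = trans (cong (_+ ballot a (suc b)) (sum₀-ballot a b (≤-trans (*-monoʳ-≤ 2 (n≤1+n b)) h))) (sym (ballot-step a b h))

-- One level of the tree: each summation moves onto the ballot numbers as a horizontal step, and the
-- shift by `suc` lengthens the convolution by one term.
conv-ballot-step : ∀ n g → conv (ballot (2 * n)) (sum₁ (λ s → sum₁ g (suc s))) n ≡ conv (ballot (2 * suc n)) g (suc n)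
conv-ballot-step n g = begin
  conv (ballot (2 * n)) (sum₁ h) n
    ≡⟨ conv-sum (ballot (2 * n)) h n ⟩
  conv (sum₀ (ballot (2 * n))) h n
    ≡⟨ conv-cong n (λ i i≤n → sum₀-ballot (2 * n) i (≤-trans (*-monoʳ-≤ 2 i≤n) (n≤1+n _))) (λ _ → refl) ⟩
  conv (ballot (suc (2 * n))) h n
    ≡⟨ sym (+-identityʳ _) ⟩
  conv (ballot (suc (2 * n))) h n + 0
    -- The additional term of the longer convolution sits just outside the boundary, where the
    -- ballot number vanishes.
    ≡⟨ cong (λ x → conv (ballot (suc (2 * n))) h n + x * sum₁ g 1) (sym (ballot-zero (suc (2 * n)) n (lem n))) ⟩
  conv (ballot (suc (2 * n))) h n + ballot (suc (2 * n)) (suc n) * sum₁ g 1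
    ≡⟨ sym (conv-last (ballot (suc (2 * n))) (sum₁ g) n) ⟩
  conv (ballot (suc (2 * n))) (sum₁ g) (suc n)
    ≡⟨ conv-sum (ballot (suc (2 * n))) g (suc n) ⟩
  conv (sum₀ (ballot (suc (2 * n)))) g (suc n)
    ≡⟨ conv-cong (suc n) (λ i i≤n → trans (sum₀-ballot (suc (2 * n)) i (≤-trans (*-monoʳ-≤ 2 i≤n) (≤-reflexive (lem n)))) (cong (λ k → ballot k i) (sym (lem n)))) (λ _ → refl) ⟩
  conv (ballot (2 * suc n)) g (suc n) ∎
  where
  open ≡-Reasoning
  h = λ s → sum₁ g (suc s)
  lem : ∀ n → 2 * suc n ≡ suc (suc (2 * n))
  lem = solve-∀

-- Its partial sums are 1 at all positive arguments, so it produces the constant test function;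
-- convolving with it reads off the last coefficient.
δ₁ : ℕ → ℕ
δ₁ 1 = 1
δ₁ _ = 0

sum₁-δ₁ : ∀ n → sum₁ δ₁ (suc n) ≡ 1
sum₁-δ₁ zero    = refl
sum₁-δ₁ (suc n) = trans (+-identityʳ _) (sum₁-δ₁ n)

conv-δ₁ : ∀ u n → conv u δ₁ n ≡ u n
conv-δ₁ u zero    = *-identityʳ (u 0)
conv-δ₁ u (suc n) = cong₂ _+_ (*-zeroʳ (u 0)) (conv-δ₁ (u ∘ suc) n)

-- Admissible cuts of a word

χ : ∀ {X : Set} → Dec X → ℕ
χ (yes _) = 1
χ (no _)  = 0

χ-yes : ∀ {X : Set} (d : Dec X) → X → χ d ≡ 1
χ-yes (yes _) x = refl
χ-yes (no ¬x) x = contradiction x ¬x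

χ-no : ∀ {X : Set} (d : Dec X) → ¬ X → χ d ≡ 0
χ-no (yes x) ¬x = contradiction x ¬x
χ-no (no _)  ¬x = refl

χ-cong : ∀ {X Y : Set} (d : Dec X) (e : Dec Y) → (X → Y) → (Y → X) → χ d ≡ χ e
χ-cong (yes x) e f g = sym (χ-yes e (f x))
χ-cong (no ¬x) e f g = sym (χ-no e (¬x ∘ g))

Word : Set
Word = List ℕ

-- A cut of a word w is a pair (Y , z) with w ≡ Y ʳ++ z: the part before the cut is stored reversed.
Cut : Set
Cut = Word × Word

keepIf : ∀ {X A : Set} → Dec X → A → List A → List A
keepIf (yes _) x xs = x ∷ xs
keepIf (no _)  x xs = xs

module _ {R : Word → Word → Set} (R? : ∀ Y z → Dec (R Y z)) where

  cutsFrom : Word → Word → List Cut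
  cutsFrom Y []      = keepIf (R? Y []) (Y , []) []
  cutsFrom Y (x ∷ z) = keepIf (R? Y (x ∷ z)) (Y , x ∷ z) (cutsFrom (x ∷ Y) z)

  count : Word → Word → ℕ
  count Y []      = χ (R? Y [])
  count Y (x ∷ z) = χ (R? Y (x ∷ z)) + count (x ∷ Y) z

  countUpTo : Word → Word → ℕ
  countUpTo []      z = χ (R? [] z)
  countUpTo (x ∷ Y) z = countUpTo Y (x ∷ z) + χ (R? (x ∷ Y) z)

  count-split : ∀ Y x z → count [] (Y ʳ++ (x ∷ z)) ≡ countUpTo Y (x ∷ z) + count (x ∷ Y) z
  count-split []      x z = refl
  count-split (y ∷ Y) x z = trans (count-split Y y (x ∷ z)) (sym (+-assoc (countUpTo Y (y ∷ x ∷ z)) _ _))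

  count-end : ∀ Y → count [] (Y ʳ++ []) ≡ countUpTo Y []
  count-end []      = refl
  count-end (y ∷ Y) = count-split Y y []

  private
    keepIf-head : ∀ {X A : Set} (d : Dec X) {x : A} {xs} → X → x ∈ keepIf d x xs
    keepIf-head (yes _) p = here refl
    keepIf-head (no ¬p) p = contradiction p ¬p

    keepIf-tail : ∀ {X A : Set} (d : Dec X) {x y : A} {xs} → y ∈ xs → y ∈ keepIf d x xs
    keepIf-tail (yes _) p = there p
    keepIf-tail (no _)  p = p

  ∈cuts⁻ : ∀ Y z {c} → c ∈ cutsFrom Y z → R (proj₁ c) (proj₂ c) × proj₁ c ʳ++ proj₂ c ≡ Y ʳ++ z
  ∈cuts⁻ Y [] p with R? Y [] | p
  ... | yes r | here refl = r , refl
  ∈cuts⁻ Y (x ∷ z) p with R? Y (x ∷ z) | p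
  ... | yes r | here refl = r , refl
  ... | yes r | there q   = ∈cuts⁻ (x ∷ Y) z q
  ... | no _  | q         = ∈cuts⁻ (x ∷ Y) z q

  private
    cuts-head : ∀ {Y z} → R Y z → (Y , z) ∈ cutsFrom Y z
    cuts-head {Y} {[]}    r = keepIf-head (R? Y []) r
    cuts-head {Y} {x ∷ z} r = keepIf-head (R? Y (x ∷ z)) r

    cuts-tail : ∀ Y z {c} → c ∈ cutsFrom Y z → c ∈ cutsFrom [] (Y ʳ++ z)
    cuts-tail []      z p = p
    cuts-tail (y ∷ Y) z p = cuts-tail Y (y ∷ z) (keepIf-tail (R? Y (y ∷ z)) p)

    cuts-length : ∀ Y z {c} → c ∈ cutsFrom Y z → length (proj₂ c) ≤ length z
    cuts-length Y [] p with R? Y [] | p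
    ... | yes r | here refl = ≤-refl
    cuts-length Y (x ∷ z) p with R? Y (x ∷ z) | p
    ... | yes r | here refl = ≤-refl
    ... | yes r | there q   = ≤-trans (cuts-length (x ∷ Y) z q) (n≤1+n _)
    ... | no _  | q         = ≤-trans (cuts-length (x ∷ Y) z q) (n≤1+n _)

  ∈cuts⁺ : ∀ Y z → R Y z → (Y , z) ∈ cutsFrom [] (Y ʳ++ z)
  ∈cuts⁺ Y z r = cuts-tail Y z (cuts-head r)

  cuts-unique : ∀ Y z → Unique (cutsFrom Y z)
  cuts-unique Y [] with R? Y []
  ... | yes _ = [] ∷ []
  ... | no _  = []
  cuts-unique Y (x ∷ z) with R? Y (x ∷ z)
  ... | yes _ = All.tabulate (λ q → λ { refl → 1+n≰n (cuts-length (x ∷ Y) z q) }) ∷ cuts-unique (x ∷ Y) z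
  ... | no _  = cuts-unique (x ∷ Y) z

  sumCuts : (Word → Word → ℕ) → Word → Word → ℕ
  sumCuts g Y z = sum (map (λ c → g (proj₁ c) (proj₂ c)) (cutsFrom Y z))

  sumCuts-cong : ∀ {g h} Y z → (∀ Y′ z′ → R Y′ z′ → Y′ ʳ++ z′ ≡ Y ʳ++ z → g Y′ z′ ≡ h Y′ z′) → sumCuts g Y z ≡ sumCuts h Y z
  sumCuts-cong Y [] e with R? Y []
  ... | yes r = cong (_+ 0) (e Y [] r refl)
  ... | no _  = refl
  sumCuts-cong Y (x ∷ z) e with R? Y (x ∷ z)
  ... | yes r = cong₂ _+_ (e Y (x ∷ z) r refl) (sumCuts-cong (x ∷ Y) z e)
  ... | no _  = sumCuts-cong (x ∷ Y) z e

  -- Going left, each admissible cut raises the count by one, so the values at admissible cuts are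
  -- 1, 2, ... once each.
  sum-by-count : ∀ h Y z → sumCuts (λ Y z → h (count Y z)) Y z ≡ sum₁ h (count Y z)
  sum-by-count h Y [] with R? Y [] in eq
  ... | yes r rewrite eq = +-identityʳ (h 1)
  ... | no _  = refl
  sum-by-count h Y (x ∷ z) with R? Y (x ∷ z) in eq
  ... | yes r rewrite eq = trans (cong (h (suc (count (x ∷ Y) z)) +_) (sum-by-count h (x ∷ Y) z)) (+-comm (h (suc (count (x ∷ Y) z))) _)
  ... | no _  = sum-by-count h (x ∷ Y) z

  countBefore : Word → Word → ℕ
  countBefore []      z = 0
  countBefore (x ∷ Y) z = countUpTo Y (x ∷ z)

  countUpTo-before : ∀ Y z → countUpTo Y z ≡ countBefore Y z + χ (R? Y z)
  countUpTo-before []      z = refl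
  countUpTo-before (x ∷ Y) z = refl

  -- Mirror image of `sum-by-count`. The offset is needed because the recursion moves the starting
  -- cut to the right while the cuts passed still count.
  sum-by-upTo : ∀ h Y z → sum₁ h (countBefore Y z) + sumCuts (λ Y z → h (countUpTo Y z)) Y z ≡ sum₁ h (countBefore Y z + count Y z)
  sum-by-upTo h Y [] with R? Y [] | countUpTo-before Y []
  ... | yes r | e rewrite e | +-comm (countBefore Y []) 1 = cong (sum₁ h (countBefore Y []) +_) (+-identityʳ _)
  ... | no _  | e = trans (+-identityʳ _) (cong (sum₁ h) (sym (+-identityʳ (countBefore Y []))))
  sum-by-upTo h Y (x ∷ z) with R? Y (x ∷ z) | countUpTo-before Y (x ∷ z) | sum-by-upTo h (x ∷ Y) z
  ... | yes r | e | ih rewrite e | +-comm (countBefore Y (x ∷ z)) 1 | +-suc (countBefore Y (x ∷ z)) (count (x ∷ Y) z) = trans (sym (+-assoc (sum₁ h (countBefore Y (x ∷ z))) _ _)) ih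
  ... | no _  | e | ih rewrite e | +-identityʳ (countBefore Y (x ∷ z)) = ih

  private
    sum₁-pred : ∀ h n → sum₁ (h ∘ pred) (suc n) ≡ h 0 + sum₁ h n
    sum₁-pred h zero    = sym (+-identityʳ (h 0))
    sum₁-pred h (suc n) = trans (cong (_+ h (suc n)) (sum₁-pred h n)) (+-assoc (h 0) _ _)

  -- The labels are h 1, h 2, … in order of the cuts, except that the first one comes last.
  sum-first-rotated : ∀ h r (g : Word → Word → ℕ) → R [] r → (∀ z → g [] z ≡ h (count [] r)) →
    (∀ x Y z → g (x ∷ Y) z ≡ h (countBefore (x ∷ Y) z)) → sumCuts g [] r ≡ sum₁ h (count [] r)
  sum-first-rotated h [] g r p q with R? [] [] | p []
  ... | yes _ | e = trans (+-identityʳ _) e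
  ... | no ¬r | _ = contradiction r ¬r
  sum-first-rotated h (x ∷ z) g r p q with R? [] (x ∷ z) in eq | p (x ∷ z)
  ... | no ¬r | _ = contradiction r ¬r
  ... | yes _ | e = trans (+-comm (g [] (x ∷ z)) _) (cong₂ _+_ rest e)
    where
    open ≡-Reasoning
    tails : ∀ y Y z → sumCuts g (y ∷ Y) z ≡ sumCuts (λ Y z → h (pred (countUpTo Y z))) (y ∷ Y) z
    tails y Y [] with R? (y ∷ Y) [] in e′
    ... | yes r = cong (_+ 0) (trans (q y Y []) (cong h (sym (trans (cong (λ k → pred (countUpTo Y (y ∷ []) + k)) (cong χ e′)) (cong pred (+-comm _ 1))))))
    ... | no _ = refl
    tails y Y (x ∷ z) with R? (y ∷ Y) (x ∷ z) in e′
    ... | yes r = cong₂ _+_ (trans (q y Y (x ∷ z)) (cong h (sym (trans (cong (λ k → pred (countUpTo Y (y ∷ x ∷ z) + k)) (cong χ e′)) (cong pred (+-comm _ 1)))))) (tails x (y ∷ Y) z)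
    ... | no _ = tails x (y ∷ Y) z
    rest : sumCuts g (x ∷ []) z ≡ sum₁ h (count (x ∷ []) z)
    -- Strictly earlier cuts are one fewer than those counted inclusively, hence `h ∘ pred`. The
    -- first cut is admissible and contributes `h 0`, which is added to make `sum-by-upTo` fit.
    rest = +-cancelˡ-≡ (h 0) _ _ (begin
      h 0 + sumCuts g (x ∷ []) z
        ≡⟨ cong₂ _+_ (cong (sum₁ (h ∘ pred)) (sym (cong χ eq))) (tails x [] z) ⟩
      sum₁ (h ∘ pred) (countBefore (x ∷ []) z) + sumCuts (λ Y z → h (pred (countUpTo Y z))) (x ∷ []) z
        ≡⟨ sum-by-upTo (h ∘ pred) (x ∷ []) z ⟩
      sum₁ (h ∘ pred) (χ (R? [] (x ∷ z)) + count (x ∷ []) z)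
        ≡⟨ cong (λ k → sum₁ (h ∘ pred) (k + count (x ∷ []) z)) (cong χ eq) ⟩
      sum₁ (h ∘ pred) (suc (count (x ∷ []) z))
        ≡⟨ sum₁-pred h (count (x ∷ []) z) ⟩
      h 0 + sum₁ h (count (x ∷ []) z) ∎)

  -- The labels are h K, …, h 2, h 1 in order of the cuts, except that the first one comes last.
  sum-last-rotated : ∀ h K (g : Word → Word → ℕ) → (∀ Y → R Y []) → (∀ Y → g Y [] ≡ h K) →
    (∀ Y x z → g Y (x ∷ z) ≡ h (count (x ∷ Y) z)) → ∀ Y z → sumCuts g Y z ≡ sum₁ h (pred (count Y z)) + h K
  sum-last-rotated h K g r p q Y [] with R? Y [] | p Y
  ... | yes _ | e = trans (+-identityʳ _) e
  ... | no ¬r | _ = contradiction (r Y) ¬r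
  sum-last-rotated h K g r p q Y (x ∷ z) with R? Y (x ∷ z) | q Y x z
  ... | no _  | _ = sum-last-rotated h K g r p q (x ∷ Y) z
  ... | yes _ | e = begin
    g Y (x ∷ z) + sumCuts g (x ∷ Y) z             ≡⟨ cong₂ _+_ e (sum-last-rotated h K g r p q (x ∷ Y) z) ⟩
    h k + (sum₁ h (pred k) + h K)                 ≡⟨ sym (+-assoc (h k) _ _) ⟩
    (h k + sum₁ h (pred k)) + h K                 ≡⟨ cong (_+ h K) (trans (+-comm (h k) _) (lem k (positive (x ∷ Y) z))) ⟩
    sum₁ h k + h K                                ∎
    where
    open ≡-Reasoning
    k = count (x ∷ Y) z
    positive : ∀ Y z → 1 ≤ count Y z
    positive Y []      = ≤-reflexive (sym (χ-yes (R? Y []) (r Y)))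
    positive Y (x ∷ z) = ≤-trans (positive (x ∷ Y) z) (m≤n+m _ _)
    lem : ∀ k → 1 ≤ k → sum₁ h (pred k) + h k ≡ sum₁ h k
    lem (suc k) _ = refl

-- Extending a word by an edge with the largest label

pick : ℕ → ℕ → Bool → ℕ
pick a b false = a
pick a b true  = b

-- The pattern α c β with letters a < b < c in which c occurs once: `before` codes α reversed and
-- `after` codes β, with false standing for a and true for b.
record Pattern : Set where
  field
    before after : List Bool
    a∈before     : false ∈ before
    b∈before     : true ∈ before

open Pattern

drop-mid : ∀ {c s} A {B} → c ∉ s → s ⊆ A ++ c ∷ B → s ⊆ A ++ B
drop-mid []      n (_ ∷ʳ p)   = p
drop-mid []      n (refl ∷ p) = contradiction (here refl) n
drop-mid (x ∷ A) n (_ ∷ʳ p)   = x ∷ʳ drop-mid A n p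
drop-mid (x ∷ A) n (refl ∷ p) = refl ∷ drop-mid A (n ∘ there) p

drop-midʳ : ∀ {c s} A {B} → c ∉ s → s ⊆ A ʳ++ (c ∷ B) → s ⊆ A ʳ++ B
drop-midʳ {s = s} A n p = subst (s ⊆_) (sym (ʳ++-defn A)) (drop-mid (reverse A) n (subst (s ⊆_) (ʳ++-defn A) p))

after-mid : ∀ {c s} A {B} → c ∉ A → c ∷ s ⊆ A ++ c ∷ B → s ⊆ B
after-mid []      n (_ ∷ʳ p)   = ⊆-trans (_ ∷ʳ ⊆-refl) p
after-mid []      n (refl ∷ p) = p
after-mid (x ∷ A) n (_ ∷ʳ p)   = after-mid A (n ∘ there) p
after-mid (x ∷ A) n (refl ∷ p) = contradiction (here refl) n

skip : ∀ {c x s B} → x ≢ c → x ∷ s ⊆ c ∷ B → x ∷ s ⊆ B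
skip n (_ ∷ʳ p)   = p
skip n (refl ∷ p) = contradiction refl n

head∈ : ∀ {x : ℕ} {s B} → x ∷ s ⊆ B → x ∈ B
head∈ p = ⊆-lookup p (here refl)

All-ʳ++⁻ : ∀ {X : ℕ → Set} Y {z} → All X (Y ʳ++ z) → All X Y × All X z
All-ʳ++⁻ []      p = [] , p
All-ʳ++⁻ (y ∷ Y) p with All-ʳ++⁻ Y p
... | q , (r ∷ s) = r ∷ q , s

All-ʳ++⁺ : ∀ {X : ℕ → Set} {Y z} → All X Y → All X z → All X (Y ʳ++ z)
All-ʳ++⁺ []      q = q
All-ʳ++⁺ (r ∷ p) q = All-ʳ++⁺ p (r ∷ q)

module _ {R : Word → Word → Set} (R? : ∀ Y z → Dec (R Y z)) where

  -- The suffix `s` stays fixed so that the hypothesis only ranges over splittings of `Y`; in use,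
  -- `s` starts with the closing letter of the new edge.
  countBefore-none : ∀ Y s → (∀ A b B → A ʳ++ (b ∷ B) ≡ Y ʳ++ [] → ¬ R A (b ∷ B ++ s)) → countBefore R? Y s ≡ 0
  countBefore-none []      s h = refl
  countBefore-none (y ∷ Y) s h = go Y y [] h
    where
    go : ∀ Y b B → (∀ A b′ B′ → A ʳ++ (b′ ∷ B′) ≡ Y ʳ++ (b ∷ B) → ¬ R A (b′ ∷ B′ ++ s)) → countUpTo R? Y (b ∷ B ++ s) ≡ 0
    go []      b B h = χ-no (R? [] _) (h [] b B refl)
    go (y ∷ Y) b B h = cong₂ _+_ (go Y y (b ∷ B) h) (χ-no (R? (y ∷ Y) _) (h (y ∷ Y) b B refl))

  countUpTo-first : ∀ Y B s → R [] (Y ʳ++ (B ++ s)) → (∀ a A B′ → (a ∷ A) ʳ++ B′ ≡ Y ʳ++ B → ¬ R (a ∷ A) (B′ ++ s)) → countUpTo R? Y (B ++ s) ≡ 1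
  countUpTo-first []      B s r h = χ-yes (R? [] _) r
  countUpTo-first (y ∷ Y) B s r h = cong₂ _+_ (countUpTo-first Y (y ∷ B) s r h) (χ-no (R? (y ∷ Y) _) (h y Y B refl))

  count-none : ∀ x A t → (∀ a A′ t′ → (a ∷ A′) ʳ++ t′ ≡ (x ∷ A) ʳ++ t → ¬ R (a ∷ A′) t′) → count R? (x ∷ A) t ≡ 0
  count-none x A []      h = χ-no (R? _ _) (h x A [] refl)
  count-none x A (y ∷ t) h = cong₂ _+_ (χ-no (R? _ _) (h x A (y ∷ t) refl)) (count-none y (x ∷ A) t h)

  count-first : ∀ t → (∀ a A′ t′ → (a ∷ A′) ʳ++ t′ ≡ t → ¬ R (a ∷ A′) t′) → count R? [] t ≡ χ (R? [] t)
  count-first []      h = refl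
  count-first (x ∷ t) h = trans (cong (χ (R? [] (x ∷ t)) +_) (count-none x [] t h)) (+-identityʳ _)

  count-last : ∀ A t → (∀ A′ → R A′ []) → (∀ A′ x t′ → A′ ʳ++ (x ∷ t′) ≡ A ʳ++ t → ¬ R A′ (x ∷ t′)) → count R? A t ≡ 1
  count-last A []      r h = χ-yes (R? A []) (r A)
  count-last A (y ∷ t) r h = cong₂ _+_ (χ-no (R? _ _) (h A y t refl)) (count-last (y ∷ A) t r h)

module _ {R R′ : Word → Word → Set} (R? : ∀ Y z → Dec (R Y z)) (R′? : ∀ Y z → Dec (R′ Y z)) where

  countUpTo-cong : ∀ Y B {s s′} →
    (∀ A B′ → A ʳ++ B′ ≡ Y ʳ++ B → (R A (B′ ++ s) → R′ A (B′ ++ s′)) × (R′ A (B′ ++ s′) → R A (B′ ++ s))) →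
    countUpTo R? Y (B ++ s) ≡ countUpTo R′? Y (B ++ s′)
  countUpTo-cong []      B h = χ-cong (R? _ _) (R′? _ _) (proj₁ (h [] B refl)) (proj₂ (h [] B refl))
  countUpTo-cong (y ∷ Y) B h = cong₂ _+_ (countUpTo-cong Y (y ∷ B) h)
    (χ-cong (R? _ _) (R′? _ _) (proj₁ (h (y ∷ Y) B refl)) (proj₂ (h (y ∷ Y) B refl)))

  count-cong : ∀ A t → (∀ A′ t′ → A′ ʳ++ t′ ≡ A ʳ++ t → (R A′ t′ → R′ A′ t′) × (R′ A′ t′ → R A′ t′)) →
    count R? A t ≡ count R′? A t
  count-cong A []      h = χ-cong (R? _ _) (R′? _ _) (proj₁ (h A [] refl)) (proj₂ (h A [] refl))
  count-cong A (x ∷ t) h = cong₂ _+_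
    (χ-cong (R? _ _) (R′? _ _) (proj₁ (h A (x ∷ t) refl)) (proj₂ (h A (x ∷ t) refl))) (count-cong (x ∷ A) t h)

module _ (π : Pattern) where

  Occurs : ℕ → ℕ → Word → Word → Set
  Occurs a b P Q = map (pick a b) (before π) ⊆ P × map (pick a b) (after π) ⊆ Q

  Bad : Word → Word → Set
  Bad P Q = ∃ λ a → ∃ λ b → a < b × Occurs a b P Q

  -- A finite search: both a and b occur before the cut, so the candidates are the letters of `P`.
  bad? : ∀ P Q → Dec (Bad P Q)
  bad? P Q = map′ to from (any? (λ a → any? (λ b → (a <? b) ×-dec ((_ ⊆? P) ×-dec (_ ⊆? Q))) P) P)
    where
    to : _ → Bad P Q
    to p with find p
    ... | a , _ , q with find q
    ... | b , _ , h = a , b , h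
    from : Bad P Q → _
    from (a , b , a<b , p , q) = lose (⊆-lookup p (∈-map⁺ (pick a b) (a∈before π))) (lose (⊆-lookup p (∈-map⁺ (pick a b) (b∈before π))) (a<b , p , q))

  -- All letters after the cut must have been opened before it.
  Ok : Word → Word → Set
  Ok P r = All (_∈ P) r × ¬ Bad P r

  ok? : ∀ P r → Dec (Ok P r)
  ok? P r = All.all? (_∈? P) r ×-dec ¬? (bad? P r)

  -- Scanning with this predicate from an empty `Y` keeps the stretch between the two new letters
  -- separate from the part `P` before the opener.
  ok-after? : ∀ P Y z → Dec (Ok (Y ++ P) z)
  ok-after? P Y z = ok? (Y ++ P) z

  count-after : ∀ P Y z → count (ok-after? P) Y z ≡ count ok? (Y ++ P) z
  count-after P Y []      = refl
  count-after P Y (x ∷ z) = cong (χ (ok? (Y ++ P) (x ∷ z)) +_) (count-after P (x ∷ Y) z)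

  -- The children whose edge opens at this cut have the labels 2, ..., K + 1 as a multiset; testing
  -- with an arbitrary `f` leaves open their order, which depends on the pattern. Only cuts behind
  -- the opener are counted, as c is unopened before it.
  Regular : Set
  Regular = ∀ c P r (f : ℕ → ℕ) → All (_< c) P → Ok P r →
    sumCuts (ok-after? P) (λ Y z → f (count ok? (c ∷ P) (Y ʳ++ (c ∷ z)))) [] r ≡ sum₁ (f ∘ suc) (count ok? P r)

  mono : ∀ {P P′ Q Q′} → P ⊆ P′ → Q ⊆ Q′ → Bad P Q → Bad P′ Q′
  mono p q (a , b , l , x , y) = a , b , l , ⊆-trans x p , ⊆-trans y q

  -- The bound on `X` gives b ≤ c. If b = c, the occurrence is ruled out by `top`; if b < c, it
  -- contains no c and survives the deletion of c.
  remove : ∀ {c X T X′ T′} → All (_≤ c) X → (∀ a → a < c → Occurs a c X T → ⊥) →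
    (∀ {s} → c ∉ s → s ⊆ X → s ⊆ X′) → (∀ {s} → c ∉ s → s ⊆ T → s ⊆ T′) → Bad X T → Bad X′ T′
  remove {c} X≤c top fX fT (a , b , a<b , p , q) with m≤n⇒m<n∨m≡n (All.lookup X≤c (⊆-lookup p (∈-map⁺ (pick a b) (b∈before π))))
  ... | inj₂ refl = ⊥-elim (top a a<b (p , q))
  ... | inj₁ b<c  = a , b , a<b , fX (fresh (before π)) p , fT (fresh (after π)) q
    where
    fresh : ∀ l → c ∉ map (pick a b) l
    fresh l i with ∈-map⁻ (pick a b) i
    ... | false , _ , refl = <-asym a<b b<c
    ... | true  , _ , refl = n≮n c b<c

⊆-insert : ∀ A (c : ℕ) {B} → A ++ B ⊆ A ++ c ∷ B
⊆-insert A c = ⊆-++⁺ (⊆-refl {A}) (c ∷ʳ ⊆-refl)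

-- Admissible cuts of a child, before and behind its closing letter.

module Child (π : Pattern) {c P} (P<c : All (_< c) P) (Y z : Word) (opened : All (_∈ P) (Y ʳ++ z)) where

  Y∈P : All (_∈ P) Y
  Y∈P = proj₁ (All-ʳ++⁻ Y opened)

  z∈P : All (_∈ P) z
  z∈P = proj₂ (All-ʳ++⁻ Y opened)

  <c : ∀ {x} → x ∈ P → x < c
  <c = All.lookup P<c

  c∉P : c ∉ P
  c∉P i = n≮n c (<c i)

  c∉ : ∀ {A} → All (_∈ P) A → c ∉ A
  c∉ p i = c∉P (All.lookup p i)

  splitY : ∀ {A B} → A ʳ++ B ≡ Y ʳ++ [] → All (_∈ P) A × All (_∈ P) B
  splitY {A} e = All-ʳ++⁻ A (subst (All (_∈ P)) (sym e) (All-ʳ++⁺ Y∈P []))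

  splitz : ∀ {A B} → A ʳ++ B ≡ z → All (_∈ P) A × All (_∈ P) B
  splitz {A} e = All-ʳ++⁻ A (subst (All (_∈ P)) (sym e) z∈P)

  ≤c : ∀ {A} → All (_∈ P) A → All (_≤ c) A
  ≤c = All.map (λ i → <⇒≤ (<c i))

  private
    first second : Word
    first  = c ∷ P
    second = c ∷ Y ++ first

  first≤c : All (_≤ c) first
  first≤c = ≤-refl ∷ All.map <⇒≤ P<c

  second≤c : All (_≤ c) second
  second≤c = ≤-refl ∷ All-++⁺ (≤c Y∈P) first≤c

  open-before : ∀ {A B} → All (_∈ P) B → All (_∈ A ++ first) (B ++ c ∷ z)
  open-before {A} b = All-++⁺ (All.map (λ i → ∈-++⁺ʳ A (there i)) b) (∈-++⁺ʳ A (here refl) ∷ All.map (λ i → ∈-++⁺ʳ A (there i)) z∈P)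

  open-after : ∀ {A t} → All (_∈ P) t → All (_∈ A ++ second) t
  open-after {A} = All.map (λ i → ∈-++⁺ʳ A (there (∈-++⁺ʳ Y (there i))))

  child-count : count (ok? π) first (Y ʳ++ (c ∷ z)) ≡ countUpTo (ok-after? π first) Y (c ∷ z) + count (ok? π) second z
  child-count = trans (sym (count-after π first [] (Y ʳ++ (c ∷ z)))) (trans (count-split (ok-after? π first) Y c z)
    (cong (countUpTo (ok-after? π first) Y (c ∷ z) +_) (count-after π first (c ∷ Y) z)))

  -- Inserting c can only create occurrences, so it suffices to exclude new ones.
  before-same : (∀ A B → All (_∈ P) A → All (_∈ P) B → Bad π (A ++ first) (B ++ c ∷ z) → Bad π (A ++ P) (B ++ z)) →
    countUpTo (ok-after? π first) Y (c ∷ z) ≡ countUpTo (ok-after? π P) Y z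
  before-same h = countUpTo-cong (ok-after? π first) (ok-after? π P) Y [] λ A B e →
    let (a , b) = splitY {A} {B} e in
    (λ { (_ , ok) → All-++⁺ (All.map (∈-++⁺ʳ A) b) (All.map (∈-++⁺ʳ A) z∈P) , λ bad → ok (mono π (⊆-insert A c) (⊆-insert B c) bad) }) ,
    (λ { (_ , ok) → open-before {A} b , ok ∘ h A B a b })

  before-last : ¬ Bad π (Y ++ first) (c ∷ z) →
    (∀ A b B → b ∈ P → Bad π (A ++ first) (b ∷ B ++ c ∷ z)) → countUpTo (ok-after? π first) Y (c ∷ z) ≡ 1
  before-last ok h = trans (countUpTo-before (ok-after? π first) Y (c ∷ z)) (cong₂ _+_
    (countBefore-none (ok-after? π first) Y (c ∷ z) λ A b B e ok → proj₂ ok (h A b B (All.head (proj₂ (splitY {A} e)))))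
    (χ-yes (ok? π (Y ++ first) (c ∷ z)) (open-before {Y} [] , ok)))

  before-first : ¬ Bad π first (Y ʳ++ (c ∷ z)) →
    (∀ a A B → a ∈ P → Bad π (a ∷ A ++ first) (B ++ c ∷ z)) → countUpTo (ok-after? π first) Y (c ∷ z) ≡ 1
  before-first ok h = countUpTo-first (ok-after? π first) Y [] (c ∷ z)
    (All-ʳ++⁺ (All.map there Y∈P) (here refl ∷ All.map there z∈P) , ok)
    λ a A B e ok → proj₂ ok (h a A B (All.head (proj₁ (splitY {a ∷ A} e))))

  before-none : (∀ A B → Bad π (A ++ first) (B ++ c ∷ z)) → countUpTo (ok-after? π first) Y (c ∷ z) ≡ 0
  before-none h = trans (countUpTo-before (ok-after? π first) Y (c ∷ z)) (cong₂ _+_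
    (countBefore-none (ok-after? π first) Y (c ∷ z) λ A b B e ok → proj₂ ok (h A (b ∷ B)))
    (χ-no (ok? π (Y ++ first) (c ∷ z)) λ ok → proj₂ ok (h Y [])))

  private
    as-after : count (ok? π) second z ≡ count (ok-after? π second) [] z
    as-after = sym (count-after π second [] z)

  after-same : (∀ A t → All (_∈ P) A → All (_∈ P) t → Bad π (A ++ second) t → Bad π (A ++ Y ++ P) t) →
    count (ok? π) second z ≡ count (ok-after? π P) Y z
  after-same h = trans as-after (trans (count-cong (ok-after? π second) (ok-after? π (Y ++ P)) [] z λ A t e →
      let (a , b) = splitz {A} {t} e in
      (λ { (_ , ok) → All.map (λ i → ∈-++⁺ʳ A (∈-++⁺ʳ Y i)) b , λ bad → ok (mono π (⊆-++⁺ (⊆-refl {A}) (c ∷ʳ ⊆-insert Y c)) ⊆-refl bad) }) ,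
      (λ { (_ , ok) → open-after {A} b , ok ∘ h A t a b }))
    (trans (count-after π (Y ++ P) [] z) (sym (count-after π P Y z))))

  after-first : (∀ a A t → a ∈ P → Bad π (a ∷ A ++ second) t) → count (ok? π) second z ≡ χ (ok? π second z)
  after-first h = trans as-after (count-first (ok-after? π second) z
    λ a A t e ok → proj₂ ok (h a A t (All.head (proj₁ (splitz {a ∷ A} e)))))

  after-last : (∀ A → ¬ Bad π (A ++ second) []) → (∀ A x t → x ∈ P → Bad π (A ++ second) (x ∷ t)) → count (ok? π) second z ≡ 1
  after-last ok h = trans as-after (count-last (ok-after? π second) [] z (λ A → [] , ok A)
    λ A x t e ok → proj₂ ok (h A x t (All.head (proj₂ (splitz {A} e)))))

  remove-before : ∀ {A B} → All (_∈ P) A → (∀ a → a < c → Occurs π a c (A ++ first) (B ++ c ∷ z) → ⊥) →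
    Bad π (A ++ first) (B ++ c ∷ z) → Bad π (A ++ P) (B ++ z)
  remove-before {A} {B} a top = remove π (All-++⁺ (≤c a) first≤c) top (drop-mid A) (drop-mid B)

  remove-after : ∀ {A t} → All (_∈ P) A → (∀ a → a < c → Occurs π a c (A ++ second) t → ⊥) →
    Bad π (A ++ second) t → Bad π (A ++ Y ++ P) t
  remove-after {A} a top = remove π (All-++⁺ (≤c a) second≤c) top
    (λ {s} n p → subst (s ⊆_) (++-assoc A Y P) (drop-mid (A ++ Y) n (subst (s ⊆_) (sym (++-assoc A Y (c ∷ P))) (drop-mid A n p))))
    (λ _ p → p)

-- The six patterns

module _ (π : Pattern) where

  private
    -- `F` is the child's label minus one, as a function of the opening cut and the closing cut; the
    -- two negated hypotheses come from the admissibility of these cuts.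
    Child≡ : (Word → Word → Word → ℕ) → Set
    Child≡ F = ∀ {c P} → All (_< c) P → ∀ Y z → All (_∈ P) (Y ʳ++ z) → ¬ Bad π P (Y ʳ++ z) → ¬ Bad π (Y ++ P) z →
      count (ok? π) (c ∷ P) (Y ʳ++ (c ∷ z)) ≡ suc (F P Y z)

    relabel : ∀ {F} → Child≡ F → ∀ {c P r} (f : ℕ → ℕ) → All (_< c) P → Ok π P r →
      sumCuts (ok-after? π P) (λ Y z → f (count (ok? π) (c ∷ P) (Y ʳ++ (c ∷ z)))) [] r ≡ sumCuts (ok-after? π P) (λ Y z → f (suc (F P Y z))) [] r
    relabel {F} ch {c} {P} {r} f P<c (op , nb) = sumCuts-cong (ok-after? π P) {λ Y z → f (count (ok? π) (c ∷ P) (Y ʳ++ (c ∷ z)))} {λ Y z → f (suc (F P Y z))} [] r λ { Y z ok refl → cong f (ch P<c Y z op nb (proj₂ ok)) }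

  regular-by-count : Child≡ (λ P Y z → count (ok-after? π P) Y z) → Regular π
  regular-by-count ch c P r f P<c ok = trans (relabel ch f P<c ok)
    (trans (sum-by-count (ok-after? π P) (f ∘ suc) [] r) (cong (sum₁ (f ∘ suc)) (count-after π P [] r)))

  regular-by-upTo : Child≡ (λ P Y z → countUpTo (ok-after? π P) Y z) → Regular π
  regular-by-upTo ch c P r f P<c ok = trans (relabel ch f P<c ok)
    (trans (sum-by-upTo (ok-after? π P) (f ∘ suc) [] r) (cong (sum₁ (f ∘ suc)) (count-after π P [] r)))

  -- Closing at once yields the largest label; otherwise the label depends on the admissible closing
  -- cuts strictly to the left.
  firstRotated : Word → Word → Word → ℕ
  firstRotated P []      z = count (ok-after? π P) [] z
  firstRotated P (x ∷ Y) z = countBefore (ok-after? π P) (x ∷ Y) z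

  regular-first-rotated : Child≡ firstRotated → Regular π
  regular-first-rotated ch c P r f P<c ok = trans (relabel ch f P<c ok) (trans
    (trans (sumCuts-cong (ok-after? π P) [] r (λ { [] z _ refl → refl ; (x ∷ Y) z _ _ → refl }))
      (sum-first-rotated (ok-after? π P) (f ∘ suc) r g ok (λ _ → refl) (λ _ _ _ → refl)))
    (cong (sum₁ (f ∘ suc)) (count-after π P [] r)))
    where
    g : Word → Word → ℕ
    g []      z = f (suc (count (ok-after? π P) [] r))
    g (x ∷ Y) z = f (suc (countBefore (ok-after? π P) (x ∷ Y) z))

  -- Closing at the very end yields the largest label; otherwise the label depends on the admissible
  -- closing cuts strictly to the right.
  lastRotated : Word → Word → Word → ℕ
  lastRotated P Y []      = count (ok-after? π P) [] (Y ʳ++ [])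
  lastRotated P Y (x ∷ z) = count (ok-after? π P) (x ∷ Y) z

  regular-last-rotated : (∀ P → ¬ Bad π P []) → Child≡ lastRotated → Regular π
  regular-last-rotated end ch c P r f P<c ok = trans (relabel ch f P<c ok) (trans
    (trans (sumCuts-cong (ok-after? π P) [] r (λ { Y [] _ refl → refl ; Y (x ∷ z) _ _ → refl }))
      (sum-last-rotated (ok-after? π P) (f ∘ suc) K g (λ Y → [] , end _) (λ _ → refl) (λ _ _ _ → refl) [] r))
    (trans (lem K (positive [] r)) (cong (sum₁ (f ∘ suc)) (count-after π P [] r))))
    where
    K = count (ok-after? π P) [] r
    g : Word → Word → ℕ
    g Y []      = f (suc K)
    g Y (x ∷ z) = f (suc (count (ok-after? π P) (x ∷ Y) z))
    positive : ∀ Y z → 1 ≤ count (ok-after? π P) Y z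
    positive Y []      = ≤-reflexive (sym (χ-yes (ok? π (Y ++ P) []) ([] , end _)))
    positive Y (x ∷ z) = ≤-trans (positive (x ∷ Y) z) (m≤n+m _ _)
    lem : ∀ k → 1 ≤ k → sum₁ (f ∘ suc) (pred k) + f (suc k) ≡ sum₁ (f ∘ suc) k
    lem (suc k) _ = refl

π12312 π12132 π12123 π12321 π12231 π12213 : Pattern
π12312 = record { before = true ∷ false ∷ [] ; after = false ∷ true ∷ [] ; a∈before = there (here refl) ; b∈before = here refl }
π12132 = record { before = false ∷ true ∷ false ∷ [] ; after = true ∷ [] ; a∈before = here refl ; b∈before = there (here refl) }
π12123 = record { before = true ∷ false ∷ true ∷ false ∷ [] ; after = [] ; a∈before = there (here refl) ; b∈before = here refl }
π12321 = record { before = true ∷ false ∷ [] ; after = true ∷ false ∷ [] ; a∈before = there (here refl) ; b∈before = here refl }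
π12231 = record { before = true ∷ true ∷ false ∷ [] ; after = false ∷ [] ; a∈before = there (there (here refl)) ; b∈before = here refl }
π12213 = record { before = false ∷ true ∷ true ∷ false ∷ [] ; after = [] ; a∈before = here refl ; b∈before = there (here refl) }

private
  second∈ : ∀ {x y : ℕ} {s B} → x ∷ y ∷ s ⊆ B → y ∈ B
  second∈ p = head∈ (∷ˡ⁻ p)

-- Between the copies of c, a letter x still to come before the closing c gives x c before and x c
-- behind the cut, so only the cut right before the closing c survives. Behind that letter no c is
-- left to be the later b.
regular-12312 : Regular π12312
regular-12312 = regular-by-count π12312 λ P<c Y z op _ nb →
  let open Child π12312 P<c Y z op in
  trans child-count (cong₂ _+_
    (before-last
      (nb ∘ remove-before {Y} {[]} Y∈P λ a a<c (_ , q) → c∉ z∈P (second∈ (skip (<⇒≢ a<c) q)))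
      λ A b B i → b , _ , <c i , ++⁺ˡ A (refl ∷ from∈ i) , refl ∷ ++⁺ˡ B (refl ∷ minimum _))
    (after-same λ A t A∈P t∈P → remove-after A∈P λ a a<c (_ , q) → c∉ t∈P (second∈ q)))

-- Between the copies, a letter x read after the opening c gives x c x before the cut and c behind
-- it, so only the cut right after the opener survives. Behind the closing letter no c is left to
-- follow.
regular-12132 : Regular π12132
regular-12132 = regular-by-count π12132 λ P<c Y z op nb₀ nb →
  let open Child π12132 P<c Y z op in
  trans child-count (cong₂ _+_
    (before-first
      (nb₀ ∘ remove π12132 first≤c (λ a a<c (p , _) → c∉P (second∈ (skip (<⇒≢ a<c) p))) (drop-mid []) (drop-midʳ Y))
      λ a A B i → a , _ , <c i , refl ∷ ++⁺ˡ A (refl ∷ from∈ i) , ++⁺ˡ B (refl ∷ minimum _))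
    (after-same λ A t A∈P t∈P → remove-after A∈P λ a a<c (_ , q) → c∉ t∈P (head∈ q)))

-- If a letter x follows the closing c, every cut between the copies has x c before and c x behind
-- it, and none survives. If the edge closes at the end, nothing follows c and all of the parent's
-- cuts survive.
regular-12321 : Regular π12321
regular-12321 = regular-last-rotated π12321 (λ { _ (_ , _ , _ , _ , ()) }) (λ where
  P<c Y [] op _ nb →
    let open Child π12321 P<c Y [] op in
    trans child-count (trans (cong₂ _+_
      (trans (before-same λ A B A∈P B∈P → remove-before A∈P λ { a a<c (_ , q) → case-⊆[] (after-mid B (c∉ B∈P) q) })
        (sym (count-end (ok-after? π12321 _) Y)))
      (χ-yes (ok? π12321 _ []) ([] , λ { (_ , _ , _ , _ , ()) })))
      (+-comm _ 1))
  P<c Y (x ∷ z) op _ nb →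
    let open Child π12321 P<c Y (x ∷ z) op in
    let x∈P = All.head z∈P in
    trans child-count (cong₂ _+_
      (before-none λ A B → x , _ , <c x∈P , ++⁺ˡ A (refl ∷ from∈ x∈P) , ++⁺ˡ B (refl ∷ refl ∷ minimum _))
      (trans (after-same λ A t A∈P t∈P → remove-after A∈P λ a a<c (_ , q) → c∉ t∈P (head∈ q))
        (cong (_+ count (ok-after? π12321 _) (x ∷ Y) z) (χ-yes (ok? π12321 _ (x ∷ z)) (All.map (∈-++⁺ʳ Y) z∈P , nb))))))
  where
  case-⊆[] : ∀ {x : ℕ} {s} → x ∷ s ⊆ [] → ⊥
  case-⊆[] ()

-- With b = c both copies must precede the cut, so nothing changes between them. Behind the second
-- copy, any letter x still to come completes x c c x, so only the end survives.
regular-12231 : Regular π12231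
regular-12231 = regular-by-upTo π12231 λ P<c Y z op _ nb →
  let open Child π12231 P<c Y z op in
  trans child-count (trans (cong₂ _+_
    (before-same λ A B A∈P B∈P → remove-before A∈P λ a a<c (p , _) → c∉P (head∈ (after-mid A (c∉ A∈P) p)))
    (after-last (λ { _ (_ , _ , _ , _ , ()) })
      λ A x t i → x , _ , <c i , ++⁺ˡ A (refl ∷ ++⁺ˡ Y (refl ∷ from∈ i)) , refl ∷ minimum _))
    (+-comm _ 1))

-- Again both copies must precede the cut. Behind the second one, the first letter x read completes
-- x c c x, so only the cut right after that copy survives.
regular-12213 : Regular π12213
regular-12213 = regular-by-upTo π12213 λ P<c Y z op _ nb →
  let open Child π12213 P<c Y z op in
  trans child-count (trans (cong₂ _+_
    (before-same λ A B A∈P B∈P → remove-before A∈P λ a a<c (p , _) → c∉P (head∈ (after-mid A (c∉ A∈P) (∷ˡ⁻ p))))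
    (trans (after-first λ a A t i → a , _ , <c i , refl ∷ ++⁺ˡ A (refl ∷ ++⁺ˡ Y (refl ∷ from∈ i)) , minimum _)
      (χ-yes (ok? π12213 _ z) (open-after {[]} z∈P ,
        nb ∘ remove-after {[]} [] λ a a<c (p , _) → c∉P (head∈ (after-mid Y (c∉ Y∈P) (∷ˡ⁻ (skip (<⇒≢ a<c) p))))))))
    (+-comm _ 1))

-- A letter y between the copies gives y c y c before every cut behind the closing letter, and none
-- survives there. Without such a letter no occurrence with b = c arises.
regular-12123 : Regular π12123
regular-12123 = regular-first-rotated π12123 (λ where
  P<c [] z op _ nb →
    let open Child π12123 P<c [] z op in
    trans child-count (cong₂ _+_
      (trans (same P<c [] z op) (χ-yes (ok? π12123 _ z) (op , nb)))
      (after-same λ A t A∈P t∈P → remove-after A∈P λ a a<c (p , _) →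
        c∉P (second∈ (skip (<⇒≢ a<c) (after-mid A (c∉ A∈P) p)))))
  {c} {P} P<c (y ∷ Y) z op _ nb →
    let open Child π12123 P<c (y ∷ Y) z op in
    let y∈P = All.head Y∈P in
    let bad : ∀ A t → Bad π12123 (A ++ c ∷ y ∷ Y ++ c ∷ P) t
        bad A t = y , _ , <c y∈P , ++⁺ˡ A (refl ∷ refl ∷ ++⁺ˡ Y (refl ∷ from∈ y∈P)) , minimum t in
    trans child-count (trans (cong₂ _+_
      (trans (same P<c (y ∷ Y) z op) (trans (countUpTo-before (ok-after? π12123 _) (y ∷ Y) z)
        (trans (cong (countUpTo (ok-after? π12123 _) Y (y ∷ z) +_) (χ-yes (ok? π12123 _ z) (All.map (∈-++⁺ʳ (y ∷ Y)) z∈P , nb))) (+-comm _ 1))))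
      (trans (after-first λ a A t i → bad (a ∷ A) t) (χ-no (ok? π12123 _ z) λ ok → proj₂ ok (bad [] z))))
      (+-identityʳ _)))
  where
  same : ∀ {c P} (P<c : All (_< c) P) Y z → All (_∈ P) (Y ʳ++ z) →
    countUpTo (ok-after? π12123 (c ∷ P)) Y (c ∷ z) ≡ countUpTo (ok-after? π12123 P) Y z
  same P<c Y z op = before-same λ A B A∈P B∈P → remove-before A∈P λ a a<c (p , _) → c∉P (second∈ (after-mid A (c∉ A∈P) p))
    where open Child π12123 P<c Y z op

-- Canonical words

∈-ʳ++⁻ : ∀ {A : Set} {x : A} P {r} → x ∈ P ʳ++ r → x ∈ P ⊎ x ∈ r
∈-ʳ++⁻ P {r} = swap ∘ reverseAcc⁻ r P

∈-ʳ++⁺ʳ : ∀ {A : Set} {x : A} P {r} → x ∈ r → x ∈ P ʳ++ r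
∈-ʳ++⁺ʳ P {r} = reverseAcc⁺ r P ∘ inj₁

∈-ʳ++⁺ˡ : ∀ {A : Set} {x : A} {P r} → x ∈ P → x ∈ P ʳ++ r
∈-ʳ++⁺ˡ {P = P} {r} = reverseAcc⁺ r P ∘ inj₂

split-at-++ : ∀ {c : ℕ} A {s A′ s′} → c ∉ A → A ++ c ∷ s ≡ A′ ++ c ∷ s′ →
  (A ≡ A′ × s ≡ s′) ⊎ ∃ λ D → A′ ≡ A ++ c ∷ D × s ≡ D ++ c ∷ s′
split-at-++ []      {A′ = []}     n e    = inj₁ (refl , ∷-injectiveʳ e)
split-at-++ []      {A′ = x ∷ A′} n refl = inj₂ (A′ , refl , refl)
split-at-++ (x ∷ A) {A′ = []}     n e    = contradiction (here (sym (∷-injectiveˡ e))) n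
split-at-++ (x ∷ A) {A′ = y ∷ A′} n e with ∷-injective e
... | refl , e′ with split-at-++ A (n ∘ there) e′
... | inj₁ (refl , q)     = inj₁ (refl , q)
... | inj₂ (D , refl , q) = inj₂ (D , refl , q)

-- `P` is free of c, so the c behind it is the first one; the c marked on the other side is the same
-- or lies in `s`.
split-at : ∀ {c : ℕ} P {s P′ s′} → c ∉ P → P ʳ++ (c ∷ s) ≡ P′ ʳ++ (c ∷ s′) →
  (P ≡ P′ × s ≡ s′) ⊎ ∃ λ D → P′ ≡ D ++ c ∷ P × s ≡ D ʳ++ (c ∷ s′)
split-at {c} P {s} {P′} {s′} n e with split-at-++ (reverse P) (n ∘ reverse⁻) (trans (sym (ʳ++-defn P)) (trans e (ʳ++-defn P′)))
... | inj₁ (p , q)     = inj₁ (reverse-injective p , q)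
... | inj₂ (D , p , q) = inj₂ (reverse D , p′ , trans q (sym (trans (ʳ++-defn (reverse D)) (cong (_++ c ∷ s′) (reverse-involutive D)))))
  where
  open ≡-Reasoning
  p′ : P′ ≡ reverse D ++ c ∷ P
  p′ = begin
    P′                                     ≡⟨ sym (reverse-involutive P′) ⟩
    reverse (reverse P′)                   ≡⟨ cong reverse p ⟩
    reverse (reverse P ++ c ∷ D)           ≡⟨ reverse-++ (reverse P) (c ∷ D) ⟩
    reverse (c ∷ D) ++ reverse (reverse P) ≡⟨ cong₂ _++_ (unfold-reverse c D) (reverse-involutive P) ⟩
    (reverse D ++ c ∷ []) ++ P             ≡⟨ ++-assoc (reverse D) (c ∷ []) P ⟩
    reverse D ++ c ∷ P ∎

split-unique : ∀ {c : ℕ} P {s P′ s′} → c ∉ P → c ∉ P′ → P ʳ++ (c ∷ s) ≡ P′ ʳ++ (c ∷ s′) → P ≡ P′ × s ≡ s′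
split-unique P n n′ e with split-at P n e
... | inj₁ pq = pq
... | inj₂ (D , refl , _) = contradiction (∈-++⁺ʳ D (here refl)) n′

private
  split-head : ∀ {α P x s Q} → α ⊆ P → x ∷ s ⊆ Q → ∃ λ P′ → ∃ λ Q′ → P ʳ++ Q ≡ P′ ʳ++ (x ∷ Q′) × α ⊆ P′ × s ⊆ Q′
  split-head p (y ∷ʳ q)   = split-head (y ∷ʳ p) q
  split-head p (refl ∷ q) = _ , _ , refl , p , q

  split-ʳ++ : ∀ α {s w} → α ʳ++ s ⊆ w → ∃ λ P → ∃ λ Q → w ≡ P ʳ++ Q × α ⊆ P × s ⊆ Q
  split-ʳ++ []      p = _ , _ , refl , [] , p
  split-ʳ++ (x ∷ α) p with split-ʳ++ α p
  ... | P , Q , e , q , r with split-head q r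
  ... | P′ , Q′ , e′ , q′ , r′ = x ∷ P′ , Q′ , trans e e′ , refl ∷ q′ , r′

split-sublist : ∀ α {c β w} → α ʳ++ (c ∷ β) ⊆ w → ∃ λ P → ∃ λ Q → w ≡ P ʳ++ (c ∷ Q) × α ⊆ P × β ⊆ Q
split-sublist α p with split-ʳ++ α p
... | P , Q , e , q , r with split-head q r
... | P′ , Q′ , e′ , q′ , r′ = P′ , Q′ , trans e e′ , q′ , r′

occ : ℕ → Word → ℕ
occ c []      = 0
occ c (x ∷ w) = χ (c ≟ x) + occ c w

occ-ʳ++ : ∀ c P r → occ c (P ʳ++ r) ≡ occ c P + occ c r
occ-ʳ++ c []      r = refl
occ-ʳ++ c (x ∷ P) r = trans (occ-ʳ++ c P (x ∷ r)) (lem (occ c P) (χ (c ≟ x)) (occ c r))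
  where
  lem : ∀ x y z → x + (y + z) ≡ (y + x) + z
  lem = solve-∀

occ-∉ : ∀ {c} w → c ∉ w → occ c w ≡ 0
occ-∉ []      n = refl
occ-∉ (x ∷ w) n = cong₂ _+_ (χ-no (_ ≟ x) (n ∘ here)) (occ-∉ w (n ∘ there))

occ-∈ : ∀ {c k} w → occ c w ≡ suc k → c ∈ w
occ-∈ {c} (x ∷ w) e with c ≟ x
... | yes p = here p
... | no _  = there (occ-∈ w e)

∉-occ : ∀ {c} w → occ c w ≡ 0 → c ∉ w
∉-occ {c} (x ∷ w) e i with c ≟ x
∉-occ (x ∷ w) e (here p)  | no ¬p = ¬p p
∉-occ (x ∷ w) e (there i) | no _  = ∉-occ w e i

first-occurrence : ∀ {c k} Q w → c ∉ Q → occ c w ≡ suc k → ∃ λ P → ∃ λ s → Q ʳ++ w ≡ P ʳ++ (c ∷ s) × c ∉ P × occ c s ≡ k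
first-occurrence {c} Q (x ∷ w) n e with c ≟ x
... | yes refl = Q , w , refl , n , suc-injective e
... | no ¬p    = first-occurrence (x ∷ Q) w (λ { (here p) → ¬p p ; (there i) → n i }) e

-- Every new letter exceeds the earlier ones by at most one; the first argument holds the letters
-- already read.
data Grow : Word → Word → Set where
  []  : ∀ {P} → Grow P []
  _∷_ : ∀ {P x r} → (∀ d → 1 ≤ d → d < x → d ∈ P) → Grow (x ∷ P) r → Grow P (x ∷ r)

grow-suffix : ∀ {P} Y {s} → Grow P (Y ʳ++ s) → Grow (Y ++ P) s
grow-suffix []      g = g
grow-suffix (y ∷ Y) g with grow-suffix Y g
... | _ ∷ h = h

-- Growth along a prefix does not look at what follows, so the tail may be exchanged.
grow-replace : ∀ {Q} P {r s} → Grow Q (P ʳ++ r) → Grow (P ++ Q) s → Grow Q (P ʳ++ s)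
grow-replace []      g h = h
grow-replace (y ∷ P) g h with grow-suffix P g
... | k ∷ _ = grow-replace P g (k ∷ h)

-- Once 1, ..., n have been read, a letter up to n + 1 skips nothing. This makes both insertion and
-- deletion of the last edge harmless.
grow-saturated : ∀ {n P r} → (∀ d → 1 ≤ d → d ≤ n → d ∈ P) → All (_≤ suc n) r → Grow P r
grow-saturated h []      = []
grow-saturated h (p ∷ q) = (λ d 1≤d d<x → h d 1≤d (≤-pred (≤-trans d<x p))) ∷ grow-saturated (λ d p q → there (h d p q)) q

record Canonical (n : ℕ) (w : Word) : Set where
  field
    grow    : Grow [] w
    letters : All (λ x → 1 ≤ x × x ≤ n) w
    twice   : ∀ d → 1 ≤ d → d ≤ n → occ d w ≡ 2

open Canonical

-- The edge with the new largest label c is opened at the cut (P , Y ʳ++ z) and closed at the cut (Y ++ P , z).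
addEdge : ℕ → Word → Word → Word → Word
addEdge c P Y z = P ʳ++ (c ∷ (Y ʳ++ (c ∷ z)))

addEdge-injective : ∀ {c P Y z P′ Y′ z′} → c ∉ P ʳ++ (Y ʳ++ z) → c ∉ P′ ʳ++ (Y′ ʳ++ z′) →
  addEdge c P Y z ≡ addEdge c P′ Y′ z′ → P ≡ P′ × Y ≡ Y′ × z ≡ z′
addEdge-injective {P = P} {Y} {z} {P′} {Y′} n n′ e with split-unique P (n ∘ ∈-ʳ++⁺ˡ) (n′ ∘ ∈-ʳ++⁺ˡ) e
... | p , q with split-unique Y (n ∘ ∈-ʳ++⁺ʳ P ∘ ∈-ʳ++⁺ˡ) (n′ ∘ ∈-ʳ++⁺ʳ P′ ∘ ∈-ʳ++⁺ˡ) q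
... | q′ , r = p , q′ , r

occ-addEdge : ∀ d c P Y z → occ d (addEdge c P Y z) ≡ 2 * χ (d ≟ c) + occ d (P ʳ++ (Y ʳ++ z))
occ-addEdge d c P Y z = begin
  occ d (addEdge c P Y z)
    ≡⟨ occ-ʳ++ d P _ ⟩
  occ d P + (χ (d ≟ c) + occ d (Y ʳ++ (c ∷ z)))
    ≡⟨ cong (λ k → occ d P + (χ (d ≟ c) + k)) (occ-ʳ++ d Y (c ∷ z)) ⟩
  occ d P + (χ (d ≟ c) + (occ d Y + (χ (d ≟ c) + occ d z)))
    ≡⟨ lem (occ d P) (χ (d ≟ c)) (occ d Y) (occ d z) ⟩
  2 * χ (d ≟ c) + (occ d P + (occ d Y + occ d z))
    ≡⟨ cong (2 * χ (d ≟ c) +_) (sym (trans (occ-ʳ++ d P _) (cong (occ d P +_) (occ-ʳ++ d Y z)))) ⟩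
  2 * χ (d ≟ c) + occ d (P ʳ++ (Y ʳ++ z)) ∎
  where
  open ≡-Reasoning
  lem : ∀ p x y z → p + (x + (y + (x + z))) ≡ 2 * x + (p + (y + z))
  lem = solve-∀

module _ {n : ℕ} where

  fresh : ∀ {w} → Canonical n w → suc n ∉ w
  fresh can i = n≮n _ (proj₂ (All.lookup (letters can) i))

  saturated : ∀ P {r} → Canonical n (P ʳ++ r) → All (_∈ P) r → ∀ d → 1 ≤ d → d ≤ n → d ∈ P
  saturated P can op d 1≤d d≤n with ∈-ʳ++⁻ P (occ-∈ _ (twice can d 1≤d d≤n))
  ... | inj₁ i = i
  ... | inj₂ i = All.lookup op i

  canonical-addEdge : ∀ P Y z → Canonical n (P ʳ++ (Y ʳ++ z)) → All (_∈ P) (Y ʳ++ z) → Canonical (suc n) (addEdge (suc n) P Y z)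
  canonical-addEdge P Y z can op = record
    { grow    = grow-replace P (grow can) (subst (λ Q → Grow Q (c ∷ (Y ʳ++ (c ∷ z)))) (sym (++-identityʳ P))
                  (grow-saturated (saturated P can op) (All.map proj₂ tail-letters)))
    ; letters = All-ʳ++⁺ (proj₁ old) tail-letters
    ; twice   = λ d 1≤d d≤c → trans (occ-addEdge d c P Y z) (two d 1≤d d≤c)
    }
    where
    c = suc n
    old : All (λ x → 1 ≤ x × x ≤ c) P × All (λ x → 1 ≤ x × x ≤ c) (Y ʳ++ z)
    old = All-ʳ++⁻ P (All.map (λ (p , q) → p , m≤n⇒m≤1+n q) (letters can))
    tail-letters : All (λ x → 1 ≤ x × x ≤ c) (c ∷ (Y ʳ++ (c ∷ z)))
    tail-letters = (s≤s z≤n , ≤-refl) ∷ All-ʳ++⁺ (proj₁ (All-ʳ++⁻ Y (proj₂ old))) ((s≤s z≤n , ≤-refl) ∷ proj₂ (All-ʳ++⁻ Y (proj₂ old)))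
    two : ∀ d → 1 ≤ d → d ≤ c → 2 * χ (d ≟ c) + occ d (P ʳ++ (Y ʳ++ z)) ≡ 2
    two d 1≤d d≤c with d ≟ c
    ... | yes refl = cong (2 +_) (occ-∉ _ (fresh can))
    ... | no d≢c   = twice can d 1≤d (≤-pred (≤∧≢⇒< d≤c d≢c))

  -- The copies of n + 1 are found as two successive first occurrences. Growth at the first copy
  -- places 1, ..., n before it, so the opening cut lies behind all openers.
  canonical-removeEdge : ∀ {w} → Canonical (suc n) w → ∃ λ P → ∃ λ Y → ∃ λ z →
    w ≡ addEdge (suc n) P Y z × Canonical n (P ʳ++ (Y ʳ++ z)) × All (_∈ P) (Y ʳ++ z)
  canonical-removeEdge {w} can with first-occurrence [] w (λ ()) (twice can (suc n) (s≤s z≤n) ≤-refl)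
  ... | P , s , refl , c∉P , e with first-occurrence [] s (λ ()) e
  ... | Y , z , refl , c∉Y , e′ = P , Y , z , refl , record
      { grow    = grow-replace P (grow can) (subst (λ Q → Grow Q (Y ʳ++ z)) (sym (++-identityʳ P))
                    (grow-saturated sat (All.map (λ (_ , q) → m≤n⇒m≤1+n q) r-letters)))
      ; letters = All-ʳ++⁺ (smaller c∉P (proj₁ split)) r-letters
      ; twice   = λ d 1≤d d≤n → trans (sym (trans (occ-addEdge d c P Y z) (cong (λ k → 2 * k + _) (χ-no (d ≟ c) λ { refl → n≮n n d≤n })))) (twice can d 1≤d (m≤n⇒m≤1+n d≤n))
      } , All.map (λ (p , q) → sat _ p q) r-letters
    where
    c = suc n
    Range : ℕ → ℕ → Set
    Range m x = 1 ≤ x × x ≤ m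
    smaller : ∀ {v} → c ∉ v → All (Range c) v → All (Range n) v
    smaller n []            = []
    smaller n ((p , q) ∷ h) = (p , ≤-pred (≤∧≢⇒< q (λ e → n (here (sym e))))) ∷ smaller (n ∘ there) h
    split : All (Range c) P × All (Range c) (c ∷ (Y ʳ++ (c ∷ z)))
    split = All-ʳ++⁻ P (letters can)
    r-letters : All (Range n) (Y ʳ++ z)
    r-letters with All-ʳ++⁻ Y (All.tail (proj₂ split))
    ... | p , (_ ∷ q) = All-ʳ++⁺ (smaller c∉Y p) (smaller (∉-occ z e′) q)
    sat : ∀ d → 1 ≤ d → d ≤ n → d ∈ P
    sat d 1≤d d≤n with subst (λ Q → Grow Q _) (++-identityʳ P) (grow-suffix P (grow can))
    ... | h ∷ _ = h d 1≤d (s≤s d≤n)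

canonical-zero : ∀ {w} → Canonical 0 w → w ≡ []
canonical-zero {[]}    can = refl
canonical-zero {x ∷ w} can with letters can
... | (p , q) ∷ _ = contradiction (≤-trans p q) λ ()

length-ʳ++-∷ : ∀ P {r r′ : Word} → length r′ ≡ suc (length r) → length (P ʳ++ r′) ≡ suc (length (P ʳ++ r))
length-ʳ++-∷ []      e = e
length-ʳ++-∷ (x ∷ P) e = length-ʳ++-∷ P (cong suc e)

canonical-length : ∀ n {w} → Canonical n w → length w ≡ 2 * n
canonical-length zero    can = cong length (canonical-zero can)
canonical-length (suc n) can with canonical-removeEdge can
... | P , Y , z , refl , can′ , _ = begin
  length (addEdge (suc n) P Y z)                ≡⟨ length-ʳ++-∷ P refl ⟩
  suc (length (P ʳ++ (Y ʳ++ (suc n ∷ z))))      ≡⟨ cong suc (length-ʳ++-∷ P (length-ʳ++-∷ Y refl)) ⟩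
  2 + length (P ʳ++ (Y ʳ++ z))                  ≡⟨ cong (2 +_) (canonical-length n can′) ⟩
  2 + 2 * n                                     ≡⟨ sym (*-suc 2 n) ⟩
  2 * suc n                                     ∎
  where open ≡-Reasoning

unique-map : ∀ {A B : Set} {f : A → B} {xs} → Unique xs → (∀ {x y} → x ∈ xs → y ∈ xs → f x ≡ f y → x ≡ y) → Unique (map f xs)
unique-map {xs = []}     u       inj = []
unique-map {f = f} {xs = x ∷ xs} (n ∷ u) inj = All.tabulate (λ i e → neq i e) ∷ unique-map u (λ i j → inj (there i) (there j))
  where
  neq : ∀ {y} → y ∈ map f xs → f x ≢ y
  neq i refl with ∈-map⁻ f i
  ... | y , j , e = All.lookup n j (inj (here refl) (there j) e)

unique-concatMap : ∀ {A B : Set} {f : A → List B} {xs} → Unique xs → (∀ {x} → x ∈ xs → Unique (f x)) →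
  (∀ {x y b} → x ∈ xs → y ∈ xs → b ∈ f x → b ∈ f y → x ≡ y) → Unique (concatMap f xs)
unique-concatMap {xs = []}     u       h inj = []
unique-concatMap {f = f} {xs = x ∷ xs} (n ∷ u) h inj = Unique-++⁺ (h (here refl)) (unique-concatMap u (h ∘ there) (λ i j → inj (there i) (there j))) disjoint
  where
  disjoint : ∀ {b} → ¬ (b ∈ f x × b ∈ concatMap f xs)
  disjoint (i , j) with find (∈-concatMap⁻ f {xs = xs} j)
  ... | y , k , l = All.lookup n k (inj (here refl) (there k) i l)

sum-concatMap : ∀ {A B : Set} (g : B → ℕ) (f : A → List B) xs → sum (map g (concatMap f xs)) ≡ sum (map (λ x → sum (map g (f x))) xs)
sum-concatMap g f []       = refl
sum-concatMap g f (x ∷ xs) = trans (cong sum (map-++ g (f x) (concatMap f xs)))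
  (trans (sum-++ (map g (f x)) _) (cong (sum (map g (f x)) +_) (sum-concatMap g f xs)))

sum-cong : ∀ {A : Set} {g h : A → ℕ} xs → (∀ {x} → x ∈ xs → g x ≡ h x) → sum (map g xs) ≡ sum (map h xs)
sum-cong []       e = refl
sum-cong (x ∷ xs) e = cong₂ _+_ (e (here refl)) (sum-cong xs (e ∘ there))

-- The generating tree

module _ (π : Pattern) where

  instanceOf : ℕ → ℕ → ℕ → Word
  instanceOf a b c = map (pick a b) (before π) ʳ++ (c ∷ map (pick a b) (after π))

  Avoids : Word → Set
  Avoids w = ∀ {a b c} → a < b → b < c → ¬ instanceOf a b c ⊆ w

  ∉-pick : ∀ {a b c} → a < b → b < c → ∀ l → c ∉ map (pick a b) l
  ∉-pick {a} {b} a<b b<c l i with ∈-map⁻ (pick a b) i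
  ... | false , _ , refl = <-asym a<b b<c
  ... | true  , _ , refl = n≮n _ b<c

  ⊆-addEdge : ∀ c P Y z → P ʳ++ (Y ʳ++ z) ⊆ addEdge c P Y z
  ⊆-addEdge c P Y z = ʳ++⁺ (⊆-refl {P}) (c ∷ʳ ʳ++⁺ (⊆-refl {Y}) (c ∷ʳ ⊆-refl))

  module _ {c P Y z} (w<c : All (_< c) (P ʳ++ (Y ʳ++ z))) where

    private
      P<c : All (_< c) P
      P<c = proj₁ (All-ʳ++⁻ P w<c)
      Y<c : All (_< c) Y
      Y<c = proj₁ (All-ʳ++⁻ Y (proj₂ (All-ʳ++⁻ P w<c)))
      z<c : All (_< c) z
      z<c = proj₂ (All-ʳ++⁻ Y (proj₂ (All-ʳ++⁻ P w<c)))
      c∉ : ∀ {A} → All (_< c) A → c ∉ A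
      c∉ p i = n≮n c (All.lookup p i)

      b-before : ∀ {a b Q R} → Occurs π a b Q R → b ∈ Q
      b-before {a} {b} (p , _) = ⊆-lookup p (∈-map⁺ (pick a b) (b∈before π))

      ∉-instance : ∀ {a b e} → a < b → b < e → e < c → c ∉ instanceOf a b e
      ∉-instance {a} {b} a<b b<e e<c i with ∈-ʳ++⁻ (map (pick a b) (before π)) i
      ... | inj₁ j           = ∉-pick a<b (<-trans b<e e<c) (before π) j
      ... | inj₂ (here refl) = n≮n _ e<c
      ... | inj₂ (there j)   = ∉-pick a<b (<-trans b<e e<c) (after π) j

    -- The largest letter e of an occurrence is compared with c. If e < c, neither copy of c is
    -- used; e > c is impossible; if e = c, it is matched to the first or the second copy, which
    -- makes the opening or the closing cut bad.
    avoids-addEdge : Avoids (P ʳ++ (Y ʳ++ z)) → ¬ Bad π P (Y ʳ++ z) → ¬ Bad π (Y ++ P) z → Avoids (addEdge c P Y z)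
    avoids-addEdge av ¬first ¬second {a} {b} {e} a<b b<e p with <-cmp e c
    ... | tri< e<c _ _ = av a<b b<e (subst (instanceOf a b e ⊆_) (++-ʳ++ Y)
          (drop-midʳ (Y ++ P) n (subst (instanceOf a b e ⊆_) (sym (++-ʳ++ Y)) (drop-midʳ P n p))))
      where
      n = ∉-instance a<b b<e e<c
    ... | tri> _ _ c<e = n≮n e (<-≤-trans (s≤s (All.lookup addEdge≤c (⊆-lookup p (∈-ʳ++⁺ʳ (map (pick a b) (before π)) (here refl))))) c<e)
      where
      addEdge≤c : All (_≤ c) (addEdge c P Y z)
      addEdge≤c = All-ʳ++⁺ (All.map <⇒≤ P<c) (≤-refl ∷ All-ʳ++⁺ (All.map <⇒≤ Y<c) (≤-refl ∷ All.map <⇒≤ z<c))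
    ... | tri≈ _ refl _ with split-sublist (map (pick a b) (before π)) p
    ... | P′ , s , eq , q , r with split-at P {P′ = P′} {s′ = s} (c∉ P<c) eq
    ... | inj₁ (refl , refl) = ¬first (a , b , a<b , q , drop-midʳ Y (∉-pick a<b b<e (after π)) r)
    ... | inj₂ (D , refl , eq′) with split-at Y {P′ = D} {s′ = s} (c∉ Y<c) eq′
    ... | inj₁ (refl , refl) = ¬second (a , b , a<b , drop-mid Y (∉-pick a<b b<e (before π)) q , r)
    ... | inj₂ (E , refl , refl) = c∉ z<c (∈-ʳ++⁺ʳ E (here refl))

    -- A bad opening cut is completed to an occurrence by the first copy of c, a bad closing cut by
    -- the second.
    avoids-removeEdge : Avoids (addEdge c P Y z) → Avoids (P ʳ++ (Y ʳ++ z)) × ¬ Bad π P (Y ʳ++ z) × ¬ Bad π (Y ++ P) z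
    avoids-removeEdge av =
      (λ a<b b<e p → av a<b b<e (⊆-trans p (⊆-addEdge c P Y z))) ,
      (λ (a , b , a<b , h) → av a<b (All.lookup P<c (b-before h))
        (⊆-trans (ʳ++⁺ (proj₁ h) (refl ∷ proj₂ h)) (ʳ++⁺ (⊆-refl {P}) (refl ∷ ʳ++⁺ (⊆-refl {Y}) (c ∷ʳ ⊆-refl))))) ,
      (λ (a , b , a<b , h) → av a<b (All.lookup YP<c (b-before h))
        (⊆-trans (ʳ++⁺ (proj₁ h) (refl ∷ proj₂ h)) (subst (_⊆ addEdge c P Y z) (sym (++-ʳ++ Y)) (ʳ++⁺ (⊆-refl {P}) (c ∷ʳ ⊆-refl)))))
      where
      YP<c : All (_< c) (Y ++ P)
      YP<c = All.tabulate λ i → All.lookup (All-ʳ++⁺ Y<c P<c) (∈-++⇒∈-ʳ++ Y i)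
        where
        ∈-++⇒∈-ʳ++ : ∀ {x : ℕ} Y {P} → x ∈ Y ++ P → x ∈ Y ʳ++ P
        ∈-++⇒∈-ʳ++ []      i           = i
        ∈-++⇒∈-ʳ++ (y ∷ Y) (here refl) = ∈-ʳ++⁺ʳ Y (here refl)
        ∈-++⇒∈-ʳ++ (y ∷ Y) (there i)   with ∈-ʳ++⁻ Y (∈-++⇒∈-ʳ++ Y i)
        ... | inj₁ j = ∈-ʳ++⁺ˡ j
        ... | inj₂ j = ∈-ʳ++⁺ʳ Y (there j)

  closings : ℕ → Cut → List Word
  closings c (P , r) = map (λ (Y , z) → addEdge c P Y z) (cutsFrom (ok-after? π P) [] r)

  children : ℕ → Word → List Word
  children c w = concatMap (closings c) (cutsFrom (ok? π) [] w)

  avoiders : ℕ → List Word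
  avoiders zero    = [] ∷ []
  avoiders (suc n) = concatMap (children (suc n)) (avoiders n)

  ∈children⁺ : ∀ c P Y z → Ok π P (Y ʳ++ z) → Ok π (Y ++ P) z → addEdge c P Y z ∈ children c (P ʳ++ (Y ʳ++ z))
  ∈children⁺ c P Y z ok ok′ = ∈-concatMap⁺ (closings c) (lose (∈cuts⁺ (ok? π) P (Y ʳ++ z) ok)
    (∈-map⁺ (λ (Y , z) → addEdge c P Y z) (∈cuts⁺ (ok-after? π P) Y z ok′)))

  ∈closings⁻ : ∀ c P r {v} → v ∈ closings c (P , r) → ∃ λ Y → ∃ λ z → r ≡ Y ʳ++ z × Ok π (Y ++ P) z × v ≡ addEdge c P Y z
  ∈closings⁻ c P r i with ∈-map⁻ (λ (Y , z) → addEdge c P Y z) i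
  ... | (Y , z) , j , e with ∈cuts⁻ (ok-after? π P) [] r j
  ... | ok , e′ = Y , z , sym e′ , ok , e

  ∈children⁻ : ∀ c w {v} → v ∈ children c w → ∃ λ P → ∃ λ Y → ∃ λ z →
    w ≡ P ʳ++ (Y ʳ++ z) × Ok π P (Y ʳ++ z) × Ok π (Y ++ P) z × v ≡ addEdge c P Y z
  ∈children⁻ c w i with find (∈-concatMap⁻ (closings c) {xs = cutsFrom (ok? π) [] w} i)
  ... | (P , r) , j , k with ∈cuts⁻ (ok? π) [] w j | ∈closings⁻ c P r k
  ... | ok , refl | Y , z , refl , ok′ , e = P , Y , z , refl , ok , ok′ , e

  letters< : ∀ {n w} → Canonical n w → All (_< suc n) w
  letters< can = All.map (λ (_ , q) → s≤s q) (letters can)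

  avoiders-sound : ∀ n {w} → w ∈ avoiders n → Canonical n w × Avoids w
  avoiders-sound zero (here refl) = record { grow = [] ; letters = [] ; twice = λ d p q → contradiction (≤-trans p q) λ () } ,
    λ {a} {b} {c} _ _ p → ∉-empty (⊆-lookup p (∈-ʳ++⁺ʳ (map (pick a b) (before π)) (here refl)))
    where
    ∉-empty : ∀ {x : ℕ} → x ∉ []
    ∉-empty ()
  avoiders-sound (suc n) i = let (w , j , k) = find (∈-concatMap⁻ (children (suc n)) {xs = avoiders n} i) in
    step (avoiders-sound n j) (∈children⁻ (suc n) w k)
    where
    step : ∀ {w v} → Canonical n w × Avoids w →
      (∃ λ P → ∃ λ Y → ∃ λ z → w ≡ P ʳ++ (Y ʳ++ z) × Ok π P (Y ʳ++ z) × Ok π (Y ++ P) z × v ≡ addEdge (suc n) P Y z) →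
      Canonical (suc n) v × Avoids v
    step (can , av) (P , Y , z , refl , (op , ¬bad) , (_ , ¬bad′) , refl) =
      canonical-addEdge P Y z can op , avoids-addEdge (letters< can) av ¬bad ¬bad′

  avoiders-complete : ∀ n {w} → Canonical n w → Avoids w → w ∈ avoiders n
  avoiders-complete zero can av = here (canonical-zero can)
  avoiders-complete (suc n) can av with canonical-removeEdge can
  ... | P , Y , z , refl , can′ , op with avoids-removeEdge (letters< can′) av
  ... | av′ , ¬bad , ¬bad′ = ∈-concatMap⁺ (children (suc n)) (lose (avoiders-complete n can′ av′)
    (∈children⁺ (suc n) P Y z (op , ¬bad) (All.map (∈-++⁺ʳ Y) (proj₂ (All-ʳ++⁻ Y op)) , ¬bad′)))

  -- The letter n + 1 does not occur in the parent, so a child determines its parent and both cuts.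
  avoiders-unique : ∀ n → Unique (avoiders n)
  avoiders-unique zero    = [] ∷ []
  avoiders-unique (suc n) = unique-concatMap (avoiders-unique n)
    (λ {w} i → let fr = fresh (proj₁ (avoiders-sound n i)) in
      unique-concatMap (cuts-unique (ok? π) [] w)
        (λ { {P , r} j → unique-map (cuts-unique (ok-after? π P) [] r) λ { {Y , z} {Y′ , z′} k l e →
           let n₁ = at-cut fr (cut-word j) in
           pair (addEdge-injective {P = P} {Y} {z} {P} {Y′} {z′} (at-cut n₁ (cong (P ʳ++_) (after-word {P} k))) (at-cut n₁ (cong (P ʳ++_) (after-word {P} l))) e) } })
        λ { {P , r} {P′ , r′} j j′ k k′ → same-cut fr j j′ (∈closings⁻ (suc n) P r k) (∈closings⁻ (suc n) P′ r′ k′) })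
    λ {w} {w′} i i′ k k′ → same-word (fresh (proj₁ (avoiders-sound n i))) (fresh (proj₁ (avoiders-sound n i′))) (∈children⁻ (suc n) w k) (∈children⁻ (suc n) w′ k′)
    where
    at-cut : ∀ {w w′ : Word} → suc n ∉ w → w′ ≡ w → suc n ∉ w′
    at-cut fr refl = fr
    cut-word : ∀ {w c} → c ∈ cutsFrom (ok? π) [] w → proj₁ c ʳ++ proj₂ c ≡ w
    cut-word {w} j = proj₂ (∈cuts⁻ (ok? π) [] w j)
    after-word : ∀ {P r c} → c ∈ cutsFrom (ok-after? π P) [] r → proj₁ c ʳ++ proj₂ c ≡ r
    after-word {P} {r} j = proj₂ (∈cuts⁻ (ok-after? π P) [] r j)
    pair : ∀ {P P′ Y Y′ z z′ : Word} → P ≡ P′ × Y ≡ Y′ × z ≡ z′ → (Y , z) ≡ (Y′ , z′)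
    pair (_ , refl , refl) = refl
    same-cut : ∀ {w v P r P′ r′} → suc n ∉ w → (P , r) ∈ cutsFrom (ok? π) [] w → (P′ , r′) ∈ cutsFrom (ok? π) [] w →
      (∃ λ Y → ∃ λ z → r ≡ Y ʳ++ z × Ok π (Y ++ P) z × v ≡ addEdge (suc n) P Y z) →
      (∃ λ Y → ∃ λ z → r′ ≡ Y ʳ++ z × Ok π (Y ++ P′) z × v ≡ addEdge (suc n) P′ Y z) → (P , r) ≡ (P′ , r′)
    same-cut {P = P} {P′ = P′} fr j j′ (Y , z , refl , _ , refl) (Y′ , z′ , refl , _ , e)
      with addEdge-injective {P = P} {Y} {z} {P′} {Y′} {z′} (at-cut fr (cut-word j)) (at-cut fr (cut-word j′)) e
    ... | refl , refl , refl = refl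
    same-word : ∀ {w w′ v} → suc n ∉ w → suc n ∉ w′ →
      (∃ λ P → ∃ λ Y → ∃ λ z → w ≡ P ʳ++ (Y ʳ++ z) × Ok π P (Y ʳ++ z) × Ok π (Y ++ P) z × v ≡ addEdge (suc n) P Y z) →
      (∃ λ P → ∃ λ Y → ∃ λ z → w′ ≡ P ʳ++ (Y ʳ++ z) × Ok π P (Y ʳ++ z) × Ok π (Y ++ P) z × v ≡ addEdge (suc n) P Y z) → w ≡ w′
    same-word fr fr′ (P , Y , z , refl , _ , _ , refl) (P′ , Y′ , z′ , refl , _ , _ , e) with addEdge-injective {P = P} {Y} {z} {P′} {Y′} {z′} fr fr′ e
    ... | refl , refl , refl = refl

  cutNumber : Word → ℕ
  cutNumber = count (ok? π) []

  countUpTo-unopened : ∀ {c} P r → c ∉ P → c ∈ r → countUpTo (ok? π) P r ≡ 0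
  countUpTo-unopened []      r n i = χ-no (ok? π [] r) λ (op , _) → n (All.lookup op i)
  countUpTo-unopened (x ∷ P) r n i = cong₂ _+_ (countUpTo-unopened P (x ∷ r) (n ∘ there) (there i)) (χ-no (ok? π (x ∷ P) r) λ (op , _) → n (All.lookup op i))

  module _ (regular : Regular π) where

    -- Regularity evaluates the sum over closing cuts, and `sum-by-count` then the sum over opening
    -- cuts.
    sum-children : ∀ c w (f : ℕ → ℕ) → All (_< c) w → sum (map (f ∘ cutNumber) (children c w)) ≡ sum₁ (sum₁ (f ∘ suc)) (cutNumber w)
    sum-children c w f w<c = begin
      sum (map (f ∘ cutNumber) (children c w))
        ≡⟨ sum-concatMap (f ∘ cutNumber) (closings c) (cutsFrom (ok? π) [] w) ⟩
      sumCuts (ok? π) (λ P r → sum (map (f ∘ cutNumber) (closings c (P , r)))) [] w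
        ≡⟨ sumCuts-cong (ok? π) [] w step ⟩
      sumCuts (ok? π) (λ P r → sum₁ (f ∘ suc) (count (ok? π) P r)) [] w
        ≡⟨ sum-by-count (ok? π) (sum₁ (f ∘ suc)) [] w ⟩
      sum₁ (sum₁ (f ∘ suc)) (cutNumber w) ∎
      where
      open ≡-Reasoning
      step : ∀ P r → Ok π P r → P ʳ++ r ≡ w → sum (map (f ∘ cutNumber) (closings c (P , r))) ≡ sum₁ (f ∘ suc) (count (ok? π) P r)
      step P r ok refl = begin
        sum (map (f ∘ cutNumber) (closings c (P , r)))
          ≡⟨ cong sum (sym (map-∘ (cutsFrom (ok-after? π P) [] r))) ⟩
        sumCuts (ok-after? π P) (λ Y z → f (cutNumber (addEdge c P Y z))) [] r
          ≡⟨ sumCuts-cong (ok-after? π P) [] r (λ Y z _ _ → cong f (trans (count-split (ok? π) P c (Y ʳ++ (c ∷ z)))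
               (cong (_+ count (ok? π) (c ∷ P) (Y ʳ++ (c ∷ z))) (countUpTo-unopened P _ c∉P (here refl))))) ⟩
        sumCuts (ok-after? π P) (λ Y z → f (count (ok? π) (c ∷ P) (Y ʳ++ (c ∷ z)))) [] r
          ≡⟨ regular c P r f P<c ok ⟩
        sum₁ (f ∘ suc) (count (ok? π) P r) ∎
        where
        P<c : All (_< c) P
        P<c = proj₁ (All-ʳ++⁻ P w<c)
        c∉P : c ∉ P
        c∉P i = n≮n c (All.lookup P<c i)

    sum-avoiders-step : ∀ n f → sum (map (f ∘ cutNumber) (avoiders (suc n))) ≡ sum (map (sum₁ (sum₁ (f ∘ suc)) ∘ cutNumber) (avoiders n))
    sum-avoiders-step n f = trans (sum-concatMap (f ∘ cutNumber) (children (suc n)) (avoiders n))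
      (sum-cong (avoiders n) λ {w} i → sum-children (suc n) w f (letters< (proj₁ (avoiders-sound n i))))

    -- The test function has the form `sum₁ g` because one level of the tree reproduces this form
    -- with another g.
    sum-avoiders : ∀ n g → sum (map (sum₁ g ∘ cutNumber) (avoiders n)) ≡ conv (ballot (2 * n)) g n
    sum-avoiders zero g = trans (+-identityʳ _) (trans (cong (sum₁ g) (χ-yes (ok? π [] []) ([] , ¬bad))) (sym (+-identityʳ (g 1))))
      where
      ∉-empty : ∀ {x : ℕ} → x ∉ []
      ∉-empty ()
      ¬bad : ¬ Bad π [] []
      ¬bad (a , b , _ , p , _) = ∉-empty (⊆-lookup p (∈-map⁺ (pick a b) (a∈before π)))
    sum-avoiders (suc n) g = trans (sum-avoiders-step n (sum₁ g)) (trans (sum-avoiders n _) (conv-ballot-step n g))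

    length-avoiders : ∀ n → length (avoiders (suc n)) ≡ ((3 * suc n) C suc n) / suc (2 * suc n)
    length-avoiders n = begin
      length (avoiders (suc n))
        ≡⟨ length-as-sum (avoiders (suc n)) ⟩
      sum (map (λ _ → 1) (avoiders (suc n)))
        -- Peeling off one level leaves positive arguments only, where the constant 1 is a partial
        -- sum of `δ₁`.
        ≡⟨ sum-avoiders-step n (λ _ → 1) ⟩
      sum (map (sum₁ (sum₁ (λ _ → 1)) ∘ cutNumber) (avoiders n))
        ≡⟨ sum-avoiders n (sum₁ (λ _ → 1)) ⟩
      conv (ballot (2 * n)) (sum₁ (λ _ → 1)) n
        ≡⟨ conv-cong n (λ _ _ → refl) (λ i → sum₁-cong (λ j → sym (sum₁-δ₁ (suc j))) (suc i)) ⟩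
      conv (ballot (2 * n)) (sum₁ (λ s → sum₁ δ₁ (suc s))) n
        ≡⟨ conv-ballot-step n δ₁ ⟩
      conv (ballot (2 * suc n)) δ₁ (suc n)
        ≡⟨ conv-δ₁ (ballot (2 * suc n)) (suc n) ⟩
      ballot (2 * suc n) (suc n)
        ≡⟨ ballot-diagonal (suc n) ⟩
      ((3 * suc n) C suc n) / suc (2 * suc n) ∎
      where
      open ≡-Reasoning
      length-as-sum : ∀ {A : Set} (xs : List A) → length xs ≡ sum (map (λ _ → 1) xs)
      length-as-sum []       = refl
      length-as-sum (x ∷ xs) = cong suc (length-as-sum xs)

-- Pattern containment as a sublist condition

and-map⁻ : ∀ {A : Set} (g : A → Bool) xs → and (map g xs) ≡ true → ∀ {x} → x ∈ xs → g x ≡ true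
and-map⁻ g (x ∷ xs) e i with g x in eq
and-map⁻ g (x ∷ xs) e (here refl) | true = eq
and-map⁻ g (x ∷ xs) e (there i)   | true = and-map⁻ g xs e i

and-map⁺ : ∀ {A : Set} (g : A → Bool) xs → (∀ {x} → x ∈ xs → g x ≡ true) → and (map g xs) ≡ true
and-map⁺ g []       h = refl
and-map⁺ g (x ∷ xs) h rewrite h (here refl) = and-map⁺ g xs (h ∘ there)

and-map-false : ∀ {A : Set} (g : A → Bool) xs → and (map g xs) ≡ false → ∃ λ x → x ∈ xs × g x ≡ false
and-map-false g (x ∷ xs) e with g x in eq
... | false = x , here refl , eq
... | true with and-map-false g xs e
... | y , i , p = y , there i , p

<⇒<ᵇ≡ : ∀ {m n} → m < n → (m <ᵇ n) ≡ true
<⇒<ᵇ≡ = Equivalence.to T-≡ ∘ <⇒<ᵇ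

<ᵇ≡⇒< : ∀ {m n} → (m <ᵇ n) ≡ true → m < n
<ᵇ≡⇒< {m} {n} e = <ᵇ⇒< m n (Equivalence.from T-≡ e)

≮⇒<ᵇ : ∀ {m n} → ¬ m < n → (m <ᵇ n) ≡ false
≮⇒<ᵇ {m} {n} h with m <ᵇ n in e
... | true  = contradiction (<ᵇ≡⇒< e) h
... | false = refl

<ᵇ-antisym : ∀ {m n} → (m <ᵇ n) ≡ false → (n <ᵇ m) ≡ false → m ≡ n
<ᵇ-antisym {m} {n} p q with <-cmp m n
... | tri≈ _ e _ = e
... | tri< h _ _ = contradiction (trans (sym p) (<⇒<ᵇ≡ h)) λ ()
... | tri> _ _ h = contradiction (trans (sym q) (<⇒<ᵇ≡ h)) λ ()

or-map⁻ : ∀ {A : Set} (g : A → Bool) xs → or (map g xs) ≡ true → ∃ λ x → x ∈ xs × g x ≡ true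
or-map⁻ g (x ∷ xs) e with g x in eq
... | true = x , here refl , eq
... | false with or-map⁻ g xs e
... | y , i , p = y , there i , p

or-map⁺ : ∀ {A : Set} (g : A → Bool) xs {x} → x ∈ xs → g x ≡ true → or (map g xs) ≡ true
or-map⁺ g (x ∷ xs) (here refl) e rewrite e = refl
or-map⁺ g (x ∷ xs) (there i) e with g x
... | true  = refl
... | false = or-map⁺ g xs i e

subseqs⁻ : ∀ w {s} → s ∈ subseqs w → s ⊆ w
subseqs⁻ []      (here refl) = []
subseqs⁻ (x ∷ w) i with ∈-++⁻ (map (x ∷_) (subseqs w)) i
... | inj₂ j = x ∷ʳ subseqs⁻ w j
... | inj₁ j with ∈-map⁻ (x ∷_) j
... | s , k , refl = refl ∷ subseqs⁻ w k

subseqs⁺ : ∀ w {s} → s ⊆ w → s ∈ subseqs w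
subseqs⁺ []      []         = here refl
subseqs⁺ (x ∷ w) (_ ∷ʳ p)   = ∈-++⁺ʳ (map (x ∷_) (subseqs w)) (subseqs⁺ w p)
subseqs⁺ (x ∷ w) (refl ∷ p) = ∈-++⁺ˡ (∈-map⁺ (_ ∷_) (subseqs⁺ w p))

SameOrder : List (ℕ × ℕ) → Set
SameOrder ps = ∀ {p q} → p ∈ ps → q ∈ ps → (proj₁ p <ᵇ proj₁ q) ≡ (proj₂ p <ᵇ proj₂ q)

orderIso-length : ∀ s t → orderIso s t ≡ true → sameLength s t ≡ true
orderIso-length s t e with sameLength s t
... | true = refl

orderIso-order : ∀ s t → orderIso s t ≡ true → SameOrder (zip s t)
orderIso-order s t e {p} {q} i j with sameLength s t
... | true with and-map⁻ _ (zip s t) (and-map⁻ _ (zip s t) e i) j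
... | h with proj₁ p <ᵇ proj₁ q | proj₂ p <ᵇ proj₂ q | h
... | true  | true  | _ = refl
... | false | false | _ = refl

-- A false conjunction exhibits two positions that compare differently in the two words; `orderIso⁺`
-- follows by contradiction.
orderIso-fails : ∀ s t → sameLength s t ≡ true → orderIso s t ≡ false → ¬ SameOrder (zip s t)
orderIso-fails s t l e same with sameLength s t
... | true with and-map-false _ (zip s t) e
... | p , i , e′ with and-map-false _ (zip s t) e′
... | q , j , h with proj₁ p <ᵇ proj₁ q | proj₂ p <ᵇ proj₂ q | same i j | h
... | true  | _ | refl | ()
... | false | _ | refl | ()

orderIso⁺ : ∀ s t → sameLength s t ≡ true → SameOrder (zip s t) → orderIso s t ≡ true
orderIso⁺ s t l same with orderIso s t in e
... | true  = refl
... | false = ⊥-elim (orderIso-fails s t l e same)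

-- Pattern letters without values: the pattern and all its instances are images of one list.
data Letter : Set where
  𝕒 𝕓 𝕔 : Letter

assign : ℕ → ℕ → ℕ → Letter → ℕ
assign a b c 𝕒 = a
assign a b c 𝕓 = b
assign a b c 𝕔 = c

module _ {a b c} (a<b : a < b) (b<c : b < c) where

  assign-mono : ∀ k l → (assign a b c k <ᵇ assign a b c l) ≡ (assign 1 2 3 k <ᵇ assign 1 2 3 l)
  assign-mono 𝕒 𝕒 = ≮⇒<ᵇ (n≮n a)
  assign-mono 𝕒 𝕓 = <⇒<ᵇ≡ a<b
  assign-mono 𝕒 𝕔 = <⇒<ᵇ≡ (<-trans a<b b<c)
  assign-mono 𝕓 𝕒 = ≮⇒<ᵇ (<-asym a<b)
  assign-mono 𝕓 𝕓 = ≮⇒<ᵇ (n≮n b)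
  assign-mono 𝕓 𝕔 = <⇒<ᵇ≡ b<c
  assign-mono 𝕔 𝕒 = ≮⇒<ᵇ (<-asym (<-trans a<b b<c))
  assign-mono 𝕔 𝕓 = ≮⇒<ᵇ (<-asym b<c)
  assign-mono 𝕔 𝕔 = ≮⇒<ᵇ (n≮n c)

sameLength-map : ∀ {A : Set} (f g : A → ℕ) k → sameLength (map f k) (map g k) ≡ true
sameLength-map f g []      = refl
sameLength-map f g (x ∷ k) = sameLength-map f g k

∈-zip-map⁻ : ∀ {A : Set} (f g : A → ℕ) k {p} → p ∈ zip (map f k) (map g k) → ∃ λ l → p ≡ (f l , g l)
∈-zip-map⁻ f g (x ∷ k) (here refl) = x , refl
∈-zip-map⁻ f g (x ∷ k) (there i)   = ∈-zip-map⁻ f g k i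

∈-zip⁺ : ∀ {A : Set} (g : A → ℕ) s k → sameLength s (map g k) ≡ true → ∀ {l} → l ∈ k → ∃ λ x → (x , g l) ∈ zip s (map g k)
∈-zip⁺ g (x ∷ s) (y ∷ k) e (here refl) = x , here refl
∈-zip⁺ g (x ∷ s) (y ∷ k) e (there i) with ∈-zip⁺ g s k e i
... | z , j = z , there j

zip-map-unique : ∀ {A : Set} (f g : A → ℕ) s k → sameLength s (map g k) ≡ true →
  (∀ {x l} → (x , g l) ∈ zip s (map g k) → x ≡ f l) → s ≡ map f k
zip-map-unique f g []      []      e h = refl
zip-map-unique f g (x ∷ s) (y ∷ k) e h = cong₂ _∷_ (h (here refl)) (zip-map-unique f g s k e (h ∘ there))

orderIso-assign⁺ : ∀ {a b c} → a < b → b < c → ∀ k → orderIso (map (assign a b c) k) (map (assign 1 2 3) k) ≡ true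
orderIso-assign⁺ {a} {b} {c} a<b b<c k = orderIso⁺ _ _ (sameLength-map (assign a b c) (assign 1 2 3) k) same
  where
  same : SameOrder (zip (map (assign a b c) k) (map (assign 1 2 3) k))
  same i j with ∈-zip-map⁻ (assign a b c) (assign 1 2 3) k i | ∈-zip-map⁻ (assign a b c) (assign 1 2 3) k j
  ... | l , refl | m , refl = assign-mono a<b b<c l m

-- The witnesses are the values of s at some position of each letter. Any other position of the same
-- letter has the same value, as neither value is smaller.
orderIso-assign⁻ : ∀ s k → 𝕒 ∈ k → 𝕓 ∈ k → 𝕔 ∈ k → orderIso s (map (assign 1 2 3) k) ≡ true →
  ∃ λ a → ∃ λ b → ∃ λ c → a < b × b < c × s ≡ map (assign a b c) k
orderIso-assign⁻ s k ia ib ic e with orderIso-length s _ e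
... | l with ∈-zip⁺ (assign 1 2 3) s k l ia | ∈-zip⁺ (assign 1 2 3) s k l ib | ∈-zip⁺ (assign 1 2 3) s k l ic
... | a , ja | b , jb | c , jc = a , b , c , <ᵇ≡⇒< (same ja jb) , <ᵇ≡⇒< (same jb jc) ,
  zip-map-unique (assign a b c) (assign 1 2 3) s k l value
  where
  same : SameOrder (zip s (map (assign 1 2 3) k))
  same = orderIso-order s _ e
  value : ∀ {x m} → (x , assign 1 2 3 m) ∈ zip s (map (assign 1 2 3) k) → x ≡ assign a b c m
  value {m = 𝕒} i = <ᵇ-antisym (same i ja) (same ja i)
  value {m = 𝕓} i = <ᵇ-antisym (same i jb) (same jb i)
  value {m = 𝕔} i = <ᵇ-antisym (same i jc) (same jc i)

letter : Bool → Letter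
letter false = 𝕒
letter true  = 𝕓

module _ (π : Pattern) where

  code : List Letter
  code = map letter (before π) ʳ++ (𝕔 ∷ map letter (after π))

  instance-code : ∀ a b c → instanceOf π a b c ≡ map (assign a b c) code
  instance-code a b c = sym (trans (map-ʳ++ (assign a b c) (map letter (before π)))
    (cong₂ (λ u v → u ʳ++ (c ∷ v)) (pick-letter (before π)) (pick-letter (after π))))
    where
    pick-letter : ∀ l → map (assign a b c) (map letter l) ≡ map (pick a b) l
    pick-letter l = trans (sym (map-∘ l)) (map-cong (λ { false → refl ; true → refl }) l)

  contains⁻ : ∀ w → contains w (instanceOf π 1 2 3) ≡ true → ¬ Avoids π w
  contains⁻ w e av with or-map⁻ (λ s → orderIso s (instanceOf π 1 2 3)) (subseqs w) e
  ... | s , i , h with orderIso-assign⁻ s code (in-before (∈-map⁺ letter (a∈before π))) (in-before (∈-map⁺ letter (b∈before π)))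
                         (∈-ʳ++⁺ʳ (map letter (before π)) (here refl)) (trans (cong (orderIso s) (sym (instance-code 1 2 3))) h)
    where
    in-before : ∀ {x} → x ∈ map letter (before π) → x ∈ code
    in-before = ∈-ʳ++⁺ˡ
  ... | a , b , c , a<b , b<c , refl = av a<b b<c (subst (_⊆ w) (sym (instance-code a b c)) (subseqs⁻ w i))

  contains⁺ : ∀ w → contains w (instanceOf π 1 2 3) ≡ false → Avoids π w
  contains⁺ w e {a} {b} {c} a<b b<c p with trans (sym e) (or-map⁺ (λ s → orderIso s (instanceOf π 1 2 3)) (subseqs w) (subseqs⁺ w p)
    (trans (cong₂ orderIso (instance-code a b c) (instance-code 1 2 3)) (orderIso-assign⁺ a<b b<c code)))
  ... | ()

-- Matchings and their canonical words

-- Duplicate-free lists with the same members are equal as bags; this allows counting without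
-- explicit bijections.
same-length : ∀ {A : Set} {xs ys : List A} → Unique xs → Unique ys → (∀ {x} → x ∈ xs → x ∈ ys) → (∀ {x} → x ∈ ys → x ∈ xs) →
  length xs ≡ length ys
same-length u v f g = ↭-length (∼bag⇒↭ (unique∧set⇒bag u v (mk⇔ f g)))

bit : Bool → ℕ
bit true  = 1
bit false = 0

rank : ∀ {N} → (Fin N → Bool) → Fin N → ℕ
rank G zero    = bit (G zero)
rank G (suc k) = bit (G zero) + rank (G ∘ suc) k

rank-positive : ∀ {N} (G : Fin N → Bool) k → G k ≡ true → 0 < rank G k
rank-positive G zero    e rewrite e = s≤s z≤n
rank-positive G (suc k) e = ≤-trans (rank-positive (G ∘ suc) k e) (m≤n+m _ _)

rank-< : ∀ {N} (G : Fin N → Bool) j k → G k ≡ true → toℕ j < toℕ k → rank G j < rank G k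
rank-< G zero    (suc k) e _       = m<m+n (bit (G zero)) (rank-positive (G ∘ suc) k e)
rank-< G (suc j) (suc k) e (s≤s h) = +-monoʳ-< (bit (G zero)) (rank-< (G ∘ suc) j k e h)

-- The rank grows by at most one per position, and only at positions in `G`, so it skips no value.
rank-onto : ∀ {N} (G : Fin N → Bool) k d → 1 ≤ d → d ≤ rank G k → ∃ λ j → toℕ j ≤ toℕ k × G j ≡ true × rank G j ≡ d
rank-onto {suc N} G k d 1≤d h with G zero in e
rank-onto {suc N} G zero d 1≤d h    | false rewrite e = contradiction (≤-trans 1≤d h) λ ()
rank-onto {suc N} G (suc k) d 1≤d h | false rewrite e with rank-onto (G ∘ suc) k d 1≤d h
... | j , j≤k , g , r = suc j , s≤s j≤k , g , trans (cong (λ b → bit b + rank (G ∘ suc) j) e) r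
rank-onto {suc N} G k 1 1≤d h             | true = zero , z≤n , e , cong bit e
rank-onto {suc N} G zero (suc (suc d)) 1≤d h    | true rewrite e with h
... | s≤s ()
rank-onto {suc N} G (suc k) (suc (suc d)) 1≤d h | true rewrite e with rank-onto (G ∘ suc) k (suc d) (s≤s z≤n) (≤-pred h)
... | j , j≤k , g , r = suc j , s≤s j≤k , g , trans (cong (λ b → bit b + rank (G ∘ suc) j) e) (cong suc r)

private
  length-filter² : ∀ {A : Set} (G Q : A → Bool) xs →
    length (filter (λ j → G j ≟ᵇ true) (filter (λ j → Q j ≟ᵇ true) xs)) ≡ sum (map (λ j → if Q j then bit (G j) else 0) xs)
  length-filter² G Q []       = refl
  length-filter² G Q (x ∷ xs) with Q x
  ... | false = length-filter² G Q xs
  ... | true with G x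
  ... | true  = cong suc (length-filter² G Q xs)
  ... | false = length-filter² G Q xs

  sum-tabulate-zero : ∀ N → sum (tabulate {n = N} (λ _ → 0)) ≡ 0
  sum-tabulate-zero zero    = refl
  sum-tabulate-zero (suc N) = sum-tabulate-zero N

  sum-tabulate-cong : ∀ {N} {f g : Fin N → ℕ} → (∀ i → f i ≡ g i) → sum (tabulate f) ≡ sum (tabulate g)
  sum-tabulate-cong {zero}  e = refl
  sum-tabulate-cong {suc N} e = cong₂ _+_ (e zero) (sum-tabulate-cong (e ∘ suc))

  -- `suc m ≤ᵇ suc n` computes to the left-hand side, which is what the recursion in `sum-rank`
  -- meets.
  <ᵇ-suc : ∀ m n → (m <ᵇ suc n) ≡ (m ≤ᵇ n)
  <ᵇ-suc zero    n = refl
  <ᵇ-suc (suc m) n = refl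

  sum-rank : ∀ {N} (G : Fin N → Bool) k → sum (tabulate (λ j → if toℕ j ≤ᵇ toℕ k then bit (G j) else 0)) ≡ rank G k
  sum-rank {suc N} G zero    = trans (cong (bit (G zero) +_) (sum-tabulate-zero N)) (+-identityʳ _)
  sum-rank {suc N} G (suc k) = cong (bit (G zero) +_)
    (trans (sum-tabulate-cong λ j → cong (λ b → if b then bit (G (suc j)) else 0) (<ᵇ-suc (toℕ j) (toℕ k))) (sum-rank (G ∘ suc) k))

length-filter-rank : ∀ {N} (G : Fin N → Bool) k →
  length (filter (λ j → G j ≟ᵇ true) (filter (λ j → (toℕ j ≤ᵇ toℕ k) ≟ᵇ true) (allFin N))) ≡ rank G k
length-filter-rank {N} G k = trans (length-filter² G (λ j → toℕ j ≤ᵇ toℕ k) (allFin N))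
  (trans (cong sum (map-tabulate id (λ j → if toℕ j ≤ᵇ toℕ k then bit (G j) else 0))) (sum-rank G k))

occ-map : ∀ {A : Set} d (f : A → ℕ) xs → occ d (map f xs) ≡ length (filter (λ x → d ≟ f x) xs)
occ-map d f []       = refl
occ-map d f (x ∷ xs) with d ≟ f x
... | yes e = trans (cong suc (occ-map d f xs)) (cong length (sym (filter-accept (λ x → d ≟ f x) {xs = xs} e)))
... | no ¬e = trans (occ-map d f xs) (cong length (sym (filter-reject (λ x → d ≟ f x) {xs = xs} ¬e)))

grow-tabulate⁺ : ∀ {N P} (f : Fin N → ℕ) → (∀ i d → 1 ≤ d → d < f i → d ∈ P ⊎ ∃ λ j → toℕ j < toℕ i × f j ≡ d) → Grow P (tabulate f)
grow-tabulate⁺ {zero}  f h = []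
grow-tabulate⁺ {suc N} {P} f h = (λ d p q → first d (h zero d p q)) ∷ grow-tabulate⁺ (f ∘ suc) λ i d p q → later i d (h (suc i) d p q)
  where
  first : ∀ d → (d ∈ P ⊎ ∃ λ j → toℕ j < 0 × f j ≡ d) → d ∈ P
  first d (inj₁ i) = i
  first d (inj₂ (_ , () , _))
  later : ∀ i d → (d ∈ P ⊎ ∃ λ j → toℕ j < suc (toℕ i) × f j ≡ d) → d ∈ f zero ∷ P ⊎ ∃ λ j → toℕ j < toℕ i × f (suc j) ≡ d
  later i d (inj₁ k)                   = inj₁ (there k)
  later i d (inj₂ (zero  , _ , e))     = inj₁ (here (sym e))
  later i d (inj₂ (suc j , s≤s l , e)) = inj₂ (j , l , e)

grow-tabulate⁻ : ∀ {N P} (f : Fin N → ℕ) → Grow P (tabulate f) → ∀ i d → 1 ≤ d → d < f i → d ∈ P ⊎ ∃ λ j → toℕ j < toℕ i × f j ≡ d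
grow-tabulate⁻ {suc N} f (h ∷ g) zero    d p q = inj₁ (h d p q)
grow-tabulate⁻ {suc N} f (h ∷ g) (suc i) d p q with grow-tabulate⁻ (f ∘ suc) g i d p q
... | inj₁ (here e)    = inj₂ (zero , s≤s z≤n , sym e)
... | inj₁ (there k)   = inj₁ k
... | inj₂ (j , l , e) = inj₂ (suc j , s≤s l , e)

maximum : ∀ {N} (f : Fin N → ℕ) → ∃ λ m → (∀ i → f i ≤ m) × (m ≡ 0 ⊎ ∃ λ i → f i ≡ m)
maximum {zero}  f = 0 , (λ ()) , inj₁ refl
maximum {suc N} f with maximum (f ∘ suc)
... | m , h , e with ≤-total (f zero) m
... | inj₂ m≤f = f zero , (λ { zero → ≤-refl ; (suc i) → ≤-trans (h i) m≤f }) , inj₂ (zero , refl)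
... | inj₁ f≤m with e
...   | inj₁ p       = m , (λ { zero → f≤m ; (suc i) → h i }) , inj₁ p
...   | inj₂ (i , p) = m , (λ { zero → f≤m ; (suc i) → h i }) , inj₂ (suc i , p)

Matching : ∀ {N} → Vec (Fin N) N → Set
Matching p = ∀ i → lookup p (lookup p i) ≡ i × lookup p i ≢ i

module _ {N} (p : Vec (Fin N) N) where

  matching⁻ : isMatching p ≡ true → Matching p
  matching⁻ e i with and-map⁻ _ (allFin N) e (∈-allFin i)
  ... | h with toℕ (lookup p (lookup p i)) ≡ᵇ toℕ i in e₁ | toℕ (lookup p i) ≡ᵇ toℕ i in e₂ | h
  ... | true | false | _ = toℕ-injective (≡ᵇ⇒≡ _ _ (Equivalence.from T-≡ e₁)) ,
    λ eq → contradiction (trans (sym e₂) (Equivalence.to T-≡ (≡⇒≡ᵇ _ _ (cong toℕ eq)))) λ ()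

  matching⁺ : Matching p → isMatching p ≡ true
  matching⁺ m = and-map⁺ _ (allFin N) λ {i} _ → both i (m i)
    where
    both : ∀ i → lookup p (lookup p i) ≡ i × lookup p i ≢ i →
      ((toℕ (lookup p (lookup p i)) ≡ᵇ toℕ i) ∧ not (toℕ (lookup p i) ≡ᵇ toℕ i)) ≡ true
    both i (q , r) with toℕ (lookup p i) ≡ᵇ toℕ i in e
    ... | true  = contradiction (toℕ-injective (≡ᵇ⇒≡ _ _ (Equivalence.from T-≡ e))) r
    ... | false rewrite Equivalence.to T-≡ (≡⇒≡ᵇ _ _ (cong toℕ q)) = refl

module _ {N} (p : Vec (Fin N) N) (m : Matching p) where

  private
    g : Fin N → Fin N
    g = lookup p
    opener : Fin N → Bool
    opener i = toℕ i <ᵇ toℕ (g i)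

  g-involutive : ∀ i → g (g i) ≡ i
  g-involutive i = proj₁ (m i)

  opener-or-closer : ∀ i → toℕ i < toℕ (g i) ⊎ toℕ (g i) < toℕ i
  opener-or-closer i with <-cmp (toℕ i) (toℕ (g i))
  ... | tri< l _ _ = inj₁ l
  ... | tri≈ _ e _ = contradiction (toℕ-injective (sym e)) (proj₂ (m i))
  ... | tri> _ _ l = inj₂ l

  min≡ˡ : ∀ {a b} → a < b → min a b ≡ a
  min≡ˡ {a} {b} l rewrite Equivalence.to T-≡ (≤⇒≤ᵇ (<⇒≤ l)) = refl

  min≡ʳ : ∀ {a b} → b < a → min a b ≡ b
  min≡ʳ {a} {b} l with a ≤ᵇ b in e
  ... | true  = contradiction (≤ᵇ⇒≤ a b (Equivalence.from T-≡ e)) (<⇒≱ l)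
  ... | false = refl

  record Opening (i : Fin N) : Set where
    field
      pos      : Fin N
      pos≤     : toℕ pos ≤ toℕ i
      pos≡     : pos ≡ i ⊎ pos ≡ g i
      opens    : toℕ pos < toℕ (g pos)
      min≡pos  : min (toℕ i) (toℕ (g i)) ≡ toℕ pos

  opening : ∀ i → Opening i
  opening i with opener-or-closer i
  ... | inj₁ l = record { pos = i ; pos≤ = ≤-refl ; pos≡ = inj₁ refl ; opens = l ; min≡pos = min≡ˡ l }
  ... | inj₂ l = record { pos = g i ; pos≤ = <⇒≤ l ; pos≡ = inj₂ refl ; opens = subst (λ j → toℕ (g i) < toℕ j) (sym (g-involutive i)) l ; min≡pos = min≡ʳ l }

  open Opening

  opener-unique : ∀ {i j} → toℕ i < toℕ (g i) → toℕ j < toℕ (g j) → i ≡ g j → i ≡ j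
  opener-unique {i} {j} p q refl = contradiction (subst (λ k → toℕ (g j) < toℕ k) (g-involutive j) p) (<⇒≯ q)

  label-rank : ∀ i → label p i ≡ rank opener (pos (opening i))
  label-rank i = trans (cong (λ k → length (filter (λ j → opener j ≟ᵇ true) (filter (λ j → (toℕ j ≤ᵇ k) ≟ᵇ true) (allFin N)))) (min≡pos (opening i)))
    (length-filter-rank opener (pos (opening i)))

  pos-opener : ∀ i → toℕ i < toℕ (g i) → pos (opening i) ≡ i
  pos-opener i l with pos≡ (opening i)
  ... | inj₁ e = e
  ... | inj₂ e = sym (opener-unique l (opens (opening i)) (trans (sym (g-involutive i)) (cong g (sym e))))

  pos-g : ∀ i → pos (opening (g i)) ≡ pos (opening i)
  pos-g i with pos≡ (opening i) | pos≡ (opening (g i))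
  ... | inj₁ e | inj₁ e′ = opener-unique (opens (opening (g i))) (opens (opening i)) (trans e′ (cong g (sym e)))
  ... | inj₁ e | inj₂ e′ = trans e′ (trans (g-involutive i) (sym e))
  ... | inj₂ e | inj₁ e′ = trans e′ (sym e)
  ... | inj₂ e | inj₂ e′ = opener-unique (opens (opening (g i))) (opens (opening i)) (trans e′ (cong g (sym e)))

  label-partner : ∀ i → label p (g i) ≡ label p i
  label-partner i = trans (label-rank (g i)) (trans (cong (rank opener) (pos-g i)) (sym (label-rank i)))

  -- Rank increases strictly at openers, so equal labels force equal openers and hence the same
  -- edge.
  label-injective : ∀ i j → label p j ≡ label p i → j ≡ i ⊎ j ≡ g i
  label-injective i j e = from-pos (pos≡ (opening i)) (pos≡ (opening j)) same-pos
    where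
    oi = pos (opening i)
    oj = pos (opening j)
    ranks : rank opener oj ≡ rank opener oi
    ranks = trans (sym (label-rank j)) (trans e (label-rank i))
    same-pos : oj ≡ oi
    same-pos with <-cmp (toℕ oj) (toℕ oi)
    ... | tri≈ _ e _ = toℕ-injective e
    ... | tri< l _ _ = contradiction (rank-< opener oj oi (<⇒<ᵇ≡ (opens (opening i))) l) (<-irrefl ranks)
    ... | tri> _ _ l = contradiction (rank-< opener oi oj (<⇒<ᵇ≡ (opens (opening j))) l) (<-irrefl (sym ranks))
    from-pos : ∀ {oi oj} → oi ≡ i ⊎ oi ≡ g i → oj ≡ j ⊎ oj ≡ g j → oj ≡ oi → j ≡ i ⊎ j ≡ g i
    from-pos (inj₁ refl) (inj₁ refl) refl = inj₁ refl
    from-pos (inj₂ refl) (inj₁ refl) refl = inj₂ refl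
    from-pos (inj₁ refl) (inj₂ refl) refl = inj₂ (sym (g-involutive j))
    from-pos (inj₂ refl) (inj₂ e′)  e = inj₁ (trans (sym (g-involutive j)) (trans (cong g (trans (sym e′) e)) (g-involutive i)))

  -- The witness is the opener of rank d; its smaller label distinguishes it from i.
  label-smaller : ∀ i d → 1 ≤ d → d < label p i → ∃ λ j → toℕ j < toℕ i × label p j ≡ d
  label-smaller i d 1≤d d<l with rank-onto opener (pos (opening i)) d 1≤d (≤-trans (<⇒≤ d<l) (≤-reflexive (label-rank i)))
  ... | j , j≤ , o , r = j , ≤∧≢⇒< (≤-trans j≤ (pos≤ (opening i))) (λ e → <-irrefl (trans (sym label-j) (cong (label p) (toℕ-injective e))) d<l) , label-j
    where
    label-j : label p j ≡ d
    label-j = trans (label-rank j) (trans (cong (rank opener) (pos-opener j (<ᵇ≡⇒< o))) r)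

  label-positive : ∀ i → 1 ≤ label p i
  label-positive i with pos (opening i) | opens (opening i) | label-rank i
  ... | k | l | e = subst (1 ≤_) (sym e) (rank-positive opener k (<⇒<ᵇ≡ l))

canonical-tabulate : ∀ {N} (p : Vec (Fin N) N) → canonical p ≡ tabulate (label p)
canonical-tabulate p = map-tabulate id (label p)

occ-label : ∀ {N} (p : Vec (Fin N) N) → Matching p → ∀ i → occ (label p i) (canonical p) ≡ 2
occ-label {N} p m i = trans (occ-map (label p i) (label p) (allFin N)) (same-length
  (filter⁺ same? (allFin⁺ N)) distinct to from)
  where
  same? : ∀ j → Dec (label p i ≡ label p j)
  same? j = label p i ≟ label p j
  edge : List (Fin N)
  edge = i ∷ lookup p i ∷ []
  distinct : Unique edge
  distinct = ((λ e → proj₂ (m i) (sym e)) ∷ []) ∷ [] ∷ []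
  to : ∀ {j} → j ∈ filter same? (allFin N) → j ∈ edge
  to {j} q with label-injective p m i j (sym (proj₂ (∈-filter⁻ same? {xs = allFin N} q)))
  ... | inj₁ e = here e
  ... | inj₂ e = there (here e)
  from : ∀ {j} → j ∈ edge → j ∈ filter same? (allFin N)
  from (here refl)         = ∈-filter⁺ same? (∈-allFin i) refl
  from (there (here refl)) = ∈-filter⁺ same? (∈-allFin (lookup p i)) (sym (label-partner p m i))

module _ {N} (p : Vec (Fin N) N) (m : Matching p) {k} (≤k : ∀ i → label p i ≤ k) where

  private
    attained : k ≡ 0 ⊎ (∃ λ i → label p i ≡ k) → ∀ d → 1 ≤ d → d ≤ k → ∃ λ i → label p i ≡ d
    attained (inj₁ e) d 1≤d d≤k = contradiction (≤-trans 1≤d (≤-trans d≤k (≤-reflexive e))) λ ()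
    attained (inj₂ (i , e)) d 1≤d d≤k = smaller (m≤n⇒m<n∨m≡n d≤k)
      where
      smaller : d < k ⊎ d ≡ k → ∃ λ i → label p i ≡ d
      smaller (inj₂ d≡k) = i , trans e (sym d≡k)
      smaller (inj₁ d<k) = let (j , _ , e′) = label-smaller p m i d 1≤d (≤-trans d<k (≤-reflexive (sym e))) in j , e′

    in-range : ∀ {x} → (∃ λ i → i ∈ allFin N × x ≡ label p i) → 1 ≤ x × x ≤ k
    in-range (i , _ , refl) = label-positive p m i , ≤k i

    two : ∀ d → (∃ λ i → label p i ≡ d) → occ d (canonical p) ≡ 2
    two d (i , e) = subst (λ d → occ d (canonical p) ≡ 2) e (occ-label p m i)

  canonical-max : k ≡ 0 ⊎ (∃ λ i → label p i ≡ k) → Canonical k (canonical p)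
  canonical-max top = record
    { grow    = subst (Grow []) (sym (canonical-tabulate p)) (grow-tabulate⁺ (label p) λ i d 1≤d d<l → inj₂ (label-smaller p m i d 1≤d d<l))
    ; letters = All.tabulate λ i → in-range (∈-map⁻ (label p) i)
    ; twice   = λ d 1≤d d≤k → two d (attained top d 1≤d d≤k)
    }

-- Edges are not counted directly: the largest label k gives a canonical word with k edges, and its
-- length 2 k must equal 2 n.
matching⇒canonical : ∀ n (p : Vec (Fin (2 * n)) (2 * n)) → Matching p → Canonical n (canonical p)
matching⇒canonical n p m = subst (λ k → Canonical k (canonical p)) k≡n can
  where
  k : ℕ
  k = proj₁ (maximum (label p))
  can : Canonical k (canonical p)
  can = canonical-max p m (proj₁ (proj₂ (maximum (label p)))) (proj₂ (proj₂ (maximum (label p))))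
  k≡n : k ≡ n
  k≡n = *-cancelˡ-≡ k n 2 (trans (sym (canonical-length k can)) (trans (length-map (label p) (allFin (2 * n))) (length-tabulate id)))

-- The p-partner of i shares the label of i under q too, so it is i or the q-partner of i, and a
-- matching has no fixed point.
canonical-injective : ∀ n {p q : Vec (Fin (2 * n)) (2 * n)} → Matching p → Matching q → canonical p ≡ canonical q → p ≡ q
canonical-injective n {p} {q} m m′ e = trans (sym (Vecₚ.tabulate∘lookup p)) (trans (Vecₚ.tabulate-cong partners) (Vecₚ.tabulate∘lookup q))
  where
  map-injective-on : ∀ {A : Set} {f g : A → ℕ} {xs x} → map f xs ≡ map g xs → x ∈ xs → f x ≡ g x
  map-injective-on {xs = _ ∷ _} e (here refl) = ∷-injectiveˡ e
  map-injective-on {xs = _ ∷ _} e (there i)   = map-injective-on (∷-injectiveʳ e) i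
  labels : ∀ i → label p i ≡ label q i
  labels i = map-injective-on e (∈-allFin i)
  partners : ∀ i → lookup p i ≡ lookup q i
  partners i = not-fixed (label-injective q m′ i (lookup p i) (trans (sym (labels (lookup p i))) (trans (label-partner p m i) (labels i))))
    where
    not-fixed : lookup p i ≡ i ⊎ lookup p i ≡ lookup q i → lookup p i ≡ lookup q i
    not-fixed (inj₁ e) = contradiction e (proj₂ (m i))
    not-fixed (inj₂ e) = e

-- The matching of a canonical word.

module _ {N n} (f : Fin N → ℕ) (can : Canonical n (tabulate f)) where

  private
    range : ∀ i → 1 ≤ f i × f i ≤ n
    range i = All.lookup (letters can) (∈-tabulate⁺ i)

    other : ∀ {L : List (Fin N)} {i} → Unique L → length L ≡ 2 → i ∈ L → ∃ λ j → j ∈ L × j ≢ i × (∀ {k} → k ∈ L → k ≡ i ⊎ k ≡ j)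
    other {a ∷ b ∷ []} ((a≢b ∷ []) ∷ _) e (here refl) = b , there (here refl) , (λ e → a≢b (sym e)) , λ { (here e) → inj₁ e ; (there (here e)) → inj₂ e }
    other {a ∷ b ∷ []} ((a≢b ∷ []) ∷ _) e (there (here refl)) = a , here refl , a≢b , λ { (here e) → inj₂ e ; (there (here e)) → inj₁ e }

    partner : ∀ i → ∃ λ j → f j ≡ f i × j ≢ i × (∀ k → f k ≡ f i → k ≡ i ⊎ k ≡ j)
    partner i = from-list (other (filter⁺ same? (allFin⁺ N))
      (trans (sym (occ-map (f i) f (allFin N))) (trans (cong (occ (f i)) (map-tabulate id f)) (twice can (f i) (proj₁ (range i)) (proj₂ (range i)))))
      (∈-filter⁺ same? (∈-allFin i) refl))
      where
      same? : ∀ j → Dec (f i ≡ f j)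
      same? j = f i ≟ f j
      from-list : (∃ λ j → j ∈ filter same? (allFin N) × j ≢ i × (∀ {k} → k ∈ filter same? (allFin N) → k ≡ i ⊎ k ≡ j)) →
        ∃ λ j → f j ≡ f i × j ≢ i × (∀ k → f k ≡ f i → k ≡ i ⊎ k ≡ j)
      from-list (j , j∈ , j≢i , only) = j , sym (proj₂ (∈-filter⁻ same? {xs = allFin N} j∈)) , j≢i ,
        λ k e → only (∈-filter⁺ same? (∈-allFin k) (sym e))

  pairing : Vec (Fin N) N
  pairing = Vec.tabulate (proj₁ ∘ partner)

  private
    g : Fin N → Fin N
    g = lookup pairing

    pairing-spec : ∀ i → f (g i) ≡ f i × g i ≢ i × (∀ k → f k ≡ f i → k ≡ i ⊎ k ≡ g i)
    pairing-spec i = subst (λ j → f j ≡ f i × j ≢ i × (∀ k → f k ≡ f i → k ≡ i ⊎ k ≡ j))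
      (sym (Vecₚ.lookup∘tabulate (proj₁ ∘ partner) i)) (proj₂ (partner i))

  pairing-matching : Matching pairing
  pairing-matching i = not-fixed (proj₂ (proj₂ (pairing-spec (g i))) i (sym (proj₁ (pairing-spec i))))
    where
    not-fixed : i ≡ g i ⊎ i ≡ g (g i) → g (g i) ≡ i × g i ≢ i
    not-fixed (inj₁ e) = contradiction (sym e) (proj₁ (proj₂ (pairing-spec i)))
    not-fixed (inj₂ e) = sym e , proj₁ (proj₂ (pairing-spec i))

  open Opening

  private
    o : ∀ i → Opening pairing pairing-matching i
    o = opening pairing pairing-matching

    f-pos : ∀ i → f (pos (o i)) ≡ f i
    f-pos i = on-edge (pos≡ (o i))
      where
      on-edge : ∀ {j} → j ≡ i ⊎ j ≡ g i → f j ≡ f i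
      on-edge (inj₁ e) = cong f e
      on-edge (inj₂ e) = trans (cong f e) (proj₁ (pairing-spec i))

    pos-first : ∀ i k → f k ≡ f i → toℕ (pos (o i)) ≤ toℕ k
    pos-first i k e = on-edge (proj₂ (proj₂ (pairing-spec i)) k e)
      where
      pos≤partner : pos (o i) ≡ i ⊎ pos (o i) ≡ g i → toℕ (pos (o i)) ≤ toℕ (g i)
      pos≤partner (inj₁ e) = ≤-trans (<⇒≤ (opens (o i))) (≤-reflexive (cong (toℕ ∘ g) e))
      pos≤partner (inj₂ e) = ≤-reflexive (cong toℕ e)
      on-edge : k ≡ i ⊎ k ≡ g i → toℕ (pos (o i)) ≤ toℕ k
      on-edge (inj₁ e) = ≤-trans (pos≤ (o i)) (≤-reflexive (cong toℕ (sym e)))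
      on-edge (inj₂ e) = ≤-trans (pos≤partner (pos≡ (o i))) (≤-reflexive (cong toℕ (sym e)))

    earlier : ∀ i d → 1 ≤ d → d < f i → ∃ λ j → toℕ j < toℕ i × f j ≡ d
    earlier i d 1≤d d<f = seen (grow-tabulate⁻ f (grow can) i d 1≤d d<f)
      where
      seen : d ∈ [] ⊎ (∃ λ j → toℕ j < toℕ i × f j ≡ d) → ∃ λ j → toℕ j < toℕ i × f j ≡ d
      seen (inj₂ h) = h

  -- The openers up to the opener of i are mapped by f bijectively to 1, ..., f i. A larger letter
  -- among them would, by growth, force f i to occur before the opener of its own edge; every
  -- smaller letter has already occurred, again by growth.
  label-pairing : ∀ i → label pairing i ≡ f i
  label-pairing i = begin
    label pairing i                  ≡⟨ cong (λ k → length (filter opener? (filter (λ j → (toℕ j ≤ᵇ k) ≟ᵇ true) (allFin N)))) (min≡pos (o i)) ⟩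
    length F                         ≡⟨ sym (length-map f F) ⟩
    length (map f F)                 ≡⟨ same-length unique-F (applyUpTo⁺₁ suc (f i) λ i<j _ → <⇒≢ (s≤s i<j)) to from ⟩
    length (applyUpTo suc (f i))     ≡⟨ length-applyUpTo suc (f i) ⟩
    f i                              ∎
    where
    open ≡-Reasoning
    opener? : (j : Fin N) → Dec ((toℕ j <ᵇ toℕ (lookup pairing j)) ≡ true)
    opener? j = (toℕ j <ᵇ toℕ (lookup pairing j)) ≟ᵇ true
    before? : (j : Fin N) → Dec ((toℕ j ≤ᵇ toℕ (pos (o i))) ≡ true)
    before? j = (toℕ j ≤ᵇ toℕ (pos (o i))) ≟ᵇ true
    F : List (Fin N)
    F = filter opener? (filter before? (allFin N))
    F⁺ : ∀ {j} → toℕ j < toℕ (g j) → toℕ j ≤ toℕ (pos (o i)) → j ∈ F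
    F⁺ {j} l h = ∈-filter⁺ opener? (∈-filter⁺ before? (∈-allFin j) (Equivalence.to T-≡ (≤⇒≤ᵇ h))) (<⇒<ᵇ≡ l)
    F⁻ : ∀ {j} → j ∈ F → toℕ j < toℕ (g j) × toℕ j ≤ toℕ (pos (o i))
    F⁻ {j} q = let (q′ , l) = ∈-filter⁻ opener? {xs = filter before? (allFin N)} q in
      <ᵇ≡⇒< l , ≤ᵇ⇒≤ _ _ (Equivalence.from T-≡ (proj₂ (∈-filter⁻ before? {xs = allFin N} q′)))
    unique-F : Unique (map f F)
    unique-F = unique-map (filter⁺ opener? (filter⁺ before? (allFin⁺ N))) λ {j} {k} p q e →
      distinct (proj₁ (F⁻ p)) (proj₁ (F⁻ q)) (proj₂ (proj₂ (pairing-spec k)) j e)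
      where
      distinct : ∀ {j k} → toℕ j < toℕ (g j) → toℕ k < toℕ (g k) → j ≡ k ⊎ j ≡ g k → j ≡ k
      distinct p q (inj₁ e) = e
      distinct p q (inj₂ e) = opener-unique pairing pairing-matching p q e
    to : ∀ {x} → x ∈ map f F → x ∈ applyUpTo suc (f i)
    to x∈ = image (∈-map⁻ f x∈)
      where
      in-interval : ∀ x → 1 ≤ x → x ≤ f i → x ∈ applyUpTo suc (f i)
      in-interval (suc x) _ h = ∈-applyUpTo⁺ suc h
      not-later : ∀ {j} → j ∈ F → ¬ ∃ λ k → toℕ k < toℕ j × f k ≡ f i
      not-later j∈ (k , k<j , e) = <-irrefl refl (<-≤-trans k<j (≤-trans (proj₂ (F⁻ j∈)) (pos-first i k e)))
      image : ∀ {x} → (∃ λ j → j ∈ F × x ≡ f j) → x ∈ applyUpTo suc (f i)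
      image (j , j∈ , refl) = in-interval (f j) (proj₁ (range j)) (≮⇒≥ λ fi<fj → not-later j∈ (earlier j (f i) (proj₁ (range i)) fi<fj))
    from : ∀ {x} → x ∈ applyUpTo suc (f i) → x ∈ map f F
    from x∈ = image (∈-applyUpTo⁻ suc x∈)
      where
      opened : ∀ {d} → (∃ λ k → toℕ k < toℕ (pos (o i)) × f k ≡ d) → d ∈ map f F
      opened (k , k<pos , e) = subst (_∈ map f F) (trans (f-pos k) e) (∈-map⁺ f (F⁺ (opens (o k)) (≤-trans (pos≤ (o k)) (<⇒≤ k<pos))))
      value : ∀ {d} → suc d < f i ⊎ suc d ≡ f i → suc d ∈ map f F
      value (inj₂ e) = subst (_∈ map f F) (trans (f-pos i) (sym e)) (∈-map⁺ f (F⁺ (opens (o i)) ≤-refl))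
      value (inj₁ l) = opened (earlier (pos (o i)) _ (s≤s z≤n) (≤-trans l (≤-reflexive (sym (f-pos i)))))
      image : ∀ {x} → (∃ λ d → d < f i × x ≡ suc d) → x ∈ map f F
      image (d , d<f , refl) = value (m≤n⇒m<n∨m≡n d<f)

  canonical-pairing : canonical pairing ≡ tabulate f
  canonical-pairing = trans (canonical-tabulate pairing) (tabulate-cong label-pairing)

canonical⇒matching : ∀ n {w} → Canonical n w → ∃ λ (p : Vec (Fin (2 * n)) (2 * n)) → Matching p × canonical p ≡ w
canonical⇒matching n {w} can with tabulated w (canonical-length n can)
  where
  tabulated : ∀ w {N} → length w ≡ N → ∃ λ (f : Fin N → ℕ) → tabulate f ≡ w
  tabulated w refl = List.lookup w , tabulate-lookup w
... | f , refl = pairing f can , pairing-matching f can , canonical-pairing f can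

-- Enumeration of the matchings and the final count.

∈-allVecs : ∀ {m k} (v : Vec (Fin m) k) → v ∈ allVecs m k
∈-allVecs Vec.[]          = here refl
∈-allVecs {m} {suc k} (x Vec.∷ v) = ∈-concatMap⁺ (λ x → map (x Vec.∷_) (allVecs m k)) (lose (∈-allFin x) (∈-map⁺ (x Vec.∷_) (∈-allVecs v)))

allVecs-unique : ∀ m k → Unique (allVecs m k)
allVecs-unique m zero    = [] ∷ []
allVecs-unique m (suc k) = unique-concatMap (allFin⁺ m)
  (λ _ → unique-map (allVecs-unique m k) (λ _ _ → Vecₚ.∷-injectiveʳ))
  λ {x} {y} _ _ i j → same-head (∈-map⁻ (x Vec.∷_) i) (∈-map⁻ (y Vec.∷_) j)
  where
  same-head : ∀ {x y : Fin m} {b : Vec (Fin m) (suc k)} →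
    (∃ λ v → v ∈ allVecs m k × b ≡ x Vec.∷ v) → (∃ λ v → v ∈ allVecs m k × b ≡ y Vec.∷ v) → x ≡ y
  same-head (_ , _ , refl) (_ , _ , e) = Vecₚ.∷-injectiveˡ e

module _ (π : Pattern) where

  private
    good? : ∀ {N} (p : Vec (Fin N) N) → Dec ((isMatching p ∧ avoids (instanceOf π 1 2 3) p) ≡ true)
    good? p = (isMatching p ∧ avoids (instanceOf π 1 2 3) p) ≟ᵇ true

    good⁻ : ∀ {N} (p : Vec (Fin N) N) → (isMatching p ∧ avoids (instanceOf π 1 2 3) p) ≡ true → Matching p × Avoids π (canonical p)
    good⁻ p e with isMatching p in e₁ | contains (canonical p) (instanceOf π 1 2 3) in e₂ | e
    ... | true | false | _ = matching⁻ p e₁ , contains⁺ π (canonical p) e₂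

    good⁺ : ∀ {N} (p : Vec (Fin N) N) → Matching p → Avoids π (canonical p) → (isMatching p ∧ avoids (instanceOf π 1 2 3) p) ≡ true
    good⁺ p m av rewrite matching⁺ p m with contains (canonical p) (instanceOf π 1 2 3) in e
    ... | true  = contradiction (λ {a} {b} {c} → av {a} {b} {c}) (contains⁻ π (canonical p) e)
    ... | false = refl

  -- Since `canonical` is injective on matchings, avoiding matchings may be counted by their words,
  -- and these are the members of `avoiders`.
  countAvoiders-length : ∀ n → countAvoiders (instanceOf π 1 2 3) n ≡ length (avoiders π n)
  countAvoiders-length n = trans (sym (length-map canonical (filter good? vecs)))
    (same-length
      (unique-map (filter⁺ good? (allVecs-unique (2 * n) (2 * n))) λ {p} {q} i j → canonical-injective n (proj₁ (good p i)) (proj₁ (good q j)))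
      (avoiders-unique π n)
      (λ i → to (∈-map⁻ canonical i))
      λ i → let (can , av) = avoiders-sound π n i in from can av (canonical⇒matching n can))
    where
    vecs = allVecs (2 * n) (2 * n)
    good : ∀ p → p ∈ filter good? vecs → Matching p × Avoids π (canonical p)
    good p i = good⁻ p (proj₂ (∈-filter⁻ good? {xs = vecs} i))
    to : ∀ {w} → (∃ λ p → p ∈ filter good? vecs × w ≡ canonical p) → w ∈ avoiders π n
    to (p , i , refl) = avoiders-complete π n (matching⇒canonical n p (proj₁ (good p i))) (proj₂ (good p i))
    from : ∀ {w} → Canonical n w → Avoids π w → (∃ λ p → Matching p × canonical p ≡ w) → w ∈ map canonical (filter good? vecs)
    from can av (p , m , refl) = ∈-map⁺ canonical (∈-filter⁺ good? (∈-allVecs p) (good⁺ p m av))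

  countAvoiders-regular : Regular π → ∀ n → 1 ≤ n → countAvoiders (instanceOf π 1 2 3) n ≡ ((3 * n) C n) / suc (2 * n)
  countAvoiders-regular regular (suc n) _ = trans (countAvoiders-length (suc n)) (length-avoiders π regular n)

theorem6 : (τ : List ℕ) →
    τ ∈ ((1 ∷ 2 ∷ 3 ∷ 1 ∷ 2 ∷ []) ∷ (1 ∷ 2 ∷ 1 ∷ 3 ∷ 2 ∷ []) ∷ (1 ∷ 2 ∷ 1 ∷ 2 ∷ 3 ∷ [])
    ∷ (1 ∷ 2 ∷ 3 ∷ 2 ∷ 1 ∷ []) ∷ (1 ∷ 2 ∷ 2 ∷ 3 ∷ 1 ∷ []) ∷ (1 ∷ 2 ∷ 2 ∷ 1 ∷ 3 ∷ []) ∷ []) →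
    (n : ℕ) → 1 ≤ n →
    countAvoiders τ n ≡ ((3 * n) C n) / suc (2 * n)
theorem6 _ (here refl)                                         = countAvoiders-regular π12312 regular-12312
theorem6 _ (there (here refl))                                 = countAvoiders-regular π12132 regular-12132
theorem6 _ (there (there (here refl)))                         = countAvoiders-regular π12123 regular-12123
theorem6 _ (there (there (there (here refl))))                 = countAvoiders-regular π12321 regular-12321
theorem6 _ (there (there (there (there (here refl)))))         = countAvoiders-regular π12231 regular-12231
theorem6 _ (there (there (there (there (there (here refl)))))) = countAvoiders-regular π12213 regular-12213
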